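{- Let $j,r\ge 0$ and $k\ge 1$ be integers with $j+r\le k$. Then \[ \sum_{s_1\ge\cdots\ge s_k\ge 0}\frac{q^{s_1^2+\cdots+s_k^2-s_1-\cdots-s_j+s_{k-r+1}+\cdots+s_k}}{(q)_{s_1-s_2}\cdots(q)_{s_{k-1}-s_k}(q)_{s_k}}=\sum_{f}q^{|f|}, \] where the sum on the right runs over all frequency sequences $f=(f_i)_{i\ge0}$ such that $f_i+f_{i+1}\le k$ for all $i\ge0$ and $f_0\le j-\max\{f_0+f_1-(k-r),0\}$.
   Context: A frequency sequence is a sequence $(f_i)_{i\ge0}$ of non-negative integers with only finitely many nonzero entries (equivalently, the multiplicities of the parts $0,1,2,\dots$ of a partition whose parts are non-negative integers); its size is $|f|=\sum_{i\ge0} i f_i$. $q$ is a complex number with $|q|<1$ (or a formal variable); $(a)_n=(a;q)_n=\prod_{m=0}^{n-1}(1-aq^m)$. $s_1+\cdots+s_j=\sum_{i=1}^j s_i$, $s_{k-r+1}+\cdots+s_k=\sum_{i=k-r+1}^k s_i$. -}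

module Defs where

open import Data.Nat as ℕ using (ℕ; zero; suc; _+_; _*_; _∸_; _≤_; _≤ᵇ_)
open import Data.Integer as ℤ using (ℤ; +_; -_)
open import Data.Bool using (if_then_else_)
open import Data.List using (List; []; _∷_; map; concatMap; upTo; zipWith; foldr; take; drop; length)
import Data.List as L
open import Data.Product using (_×_)
open import Data.Unit using (⊤)
open import Relation.Binary.PropositionalEquality using (_≢_)

Series : Set
Series = ℕ → ℤ

sumℤ : List ℤ → ℤ
sumℤ = foldr ℤ._+_ (+ 0)

oneS : Series
oneS zero    = + 1
oneS (suc _) = + 0

_⊛_ : Series → Series → Series
(F ⊛ G) n = sumℤ (map (λ i → F i ℤ.* G (n ∸ i)) (upTo (suc n)))

shift : ℕ → Series → Series
shift e F n = if e ≤ᵇ n then F (n ∸ e) else + 0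

oneMinusQ^ : ℕ → Series
oneMinusQ^ m n = oneS n ℤ.- (if m ℕ.≡ᵇ n then + 1 else + 0)

qpoch : ℕ → Series
qpoch zero    = oneS
qpoch (suc m) = qpoch m ⊛ oneMinusQ^ (suc m)

-- Reciprocal of a series with constant term 1:
-- b_0 = 1, b_n = - Σ_{i=1}^{n} F_i b_{n-i}.
-- invRev F n = [b_n, b_{n-1}, ..., b_0].
invRev : Series → ℕ → List ℤ
invRev F zero    = + 1 ∷ []
invRev F (suc n) =
  let bs = invRev F n in
  (- sumℤ (zipWith ℤ._*_ (map (λ i → F (suc i)) (upTo (suc n))) bs)) ∷ bs

recip : Series → Series
recip F n with invRev F n
... | []    = + 0
... | b ∷ _ = b

decSeqs : ℕ → ℕ → List (List ℕ)
decSeqs zero    N = [] ∷ []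
decSeqs (suc k) N = concatMap (λ a → map (a ∷_) (decSeqs k a)) (upTo (suc N))

diffs : List ℕ → List ℕ
diffs []            = []
diffs (a ∷ [])      = a ∷ []
diffs (a ∷ b ∷ t)   = (a ∸ b) ∷ diffs (b ∷ t)

sumℕ : List ℕ → ℕ
sumℕ = foldr _+_ 0

-- exponent s_1^2+...+s_k^2 - s_1 - ... - s_j + s_{k-r+1} + ... + s_k
-- (the truncated subtraction is exact since s ≤ s^2 for s ∈ ℕ)
expo : ℕ → ℕ → ℕ → List ℕ → ℕ
expo j r k s = (sumℕ (map (λ x → x * x) s) ∸ sumℕ (take j s)) + sumℕ (drop (k ∸ r) s)

term : ℕ → ℕ → ℕ → List ℕ → Series
term j r k s = shift (expo j r k s) (foldr (λ d acc → recip (qpoch d) ⊛ acc) oneS (diffs s))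

lhsPartial : ℕ → ℕ → ℕ → ℕ → Series
lhsPartial j r k N n = sumℤ (map (λ s → term j r k s n) (decSeqs k N))

-- Frequency sequences, represented by the list [f_0, f_1, ..., f_m]
-- of their entries up to the last nonzero one (all later entries are 0).

NoTrailingZero : List ℕ → Set
NoTrailingZero []          = ⊤
NoTrailingZero (x ∷ [])    = x ≢ 0
NoTrailingZero (_ ∷ y ∷ t) = NoTrailingZero (y ∷ t)

at : List ℕ → ℕ → ℕ
at []      _       = 0
at (x ∷ _) zero    = x
at (_ ∷ f) (suc i) = at f i

sizeFrom : ℕ → List ℕ → ℕ
sizeFrom i []      = 0
sizeFrom i (x ∷ f) = i * x + sizeFrom (suc i) f

size : List ℕ → ℕ
size = sizeFrom 0

Admissible : ℕ → ℕ → ℕ → List ℕ → Set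
Admissible j r k f =
  (∀ i → at f i + at f (suc i) ≤ k) ×
  (at f 0 + ((at f 0 + at f 1) ∸ (k ∸ r)) ≤ j)

{-# OPTIONS --safe #-}
module Submission where

-- Put x = q^e and let the multisum carry x^(s_1+⋯+s_k).  Summing over the smallest
-- variable n = s_k last expresses the multisum with k variables at x through the one
-- with k - 1 variables at x q^(2n) (`step`).  By induction on k, using only
-- 1/(q)_n - q^n/(q)_n = 1/(q)_{n-1}, this yields the recurrences
--   K(m, j+1; e)      = K(m+1, j; e)   + q^(e(j+1)) K(j+1, m; e+1),
--   M(r+1, m, j+1; e) = M(r, m+2, j; e) + q^(e(j+1)) K(r+j+2, m; e+1),
-- where M(r, m, j; e) has k = r + m + j variables and K(m, j; e) = M(0, m, j; e).
-- On frequency sequences f_e, f_{e+1}, … with f_i + f_{i+1} ≤ k, the first one is the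
-- split according to whether f_e ≤ j or f_e = j + 1, so K(m, j; e) counts those with
-- f_e ≤ j; the second one is the same split under the boundary condition of the theorem.

-- The variable x is forced by the induction: removing s_k = n replaces q^e by q^(e + 2n), so a
-- recurrence for k variables rests on the one for k - 1 variables at infinitely many arguments. The
-- recurrences say nothing about j = 0. That gap is closed by reading x ↦ xq as raising every weight
-- by one, K(m, j; e + 1) = M(m, j, 0; e), which in particular gives K(m, 0; e) = K(0, m; e + 1).
-- Descent in e stops because K(m, j; e) agrees with 1 below q^e, so only finitely many e matter for
-- a given coefficient. The boundary condition is needed at e = 0 only. The recurrence for M trades
-- one variable of lowest weight and one of highest weight for two of middle weight; on the side of
-- sequences this lowers j by one and raises the threshold k - r by one.

open import Defs
open import Data.Bool using (if_then_else_)
open import Data.Integer as ℤ using (ℤ; +_; -_)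
import Data.Integer.Properties as ℤₚ
import Data.Integer.Tactic.RingSolver as ℤ-Solver
open import Data.List using (List; []; _∷_; _++_; _∷ʳ_; applyUpTo; concatMap; drop; foldr; length; map; replicate; take; upTo; zipWith)
open import Data.List.Membership.Propositional using (_∈_)
open import Data.List.Membership.Propositional.Properties using (∈-map⁺; ∈-map⁻; ∈-++⁺ˡ; ∈-++⁺ʳ; ∈-++⁻)
open import Data.List.Properties using (++-assoc; ++-identityʳ; length-++; length-map; length-replicate; map-++; map-∘; map-replicate; map-upTo)
open import Data.List.Relation.Unary.All using ([])
open import Data.List.Relation.Unary.AllPairs using ([]; _∷_)
open import Data.List.Relation.Unary.Any using (here)
open import Data.List.Relation.Unary.Unique.Propositional using (Unique)
import Data.List.Relation.Unary.Unique.Propositional.Properties as Unique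
open import Data.Nat as ℕ using (ℕ; zero; suc; _+_; _*_; _∸_; _≤_; _<_; _≡ᵇ_; z≤n; s≤s)
import Data.Nat.Properties as ℕₚ
import Data.Nat.Tactic.RingSolver as ℕ-Solver
open import Data.Product using (Σ; ∃; _×_; _,_; proj₁)
open import Data.Sum using (_⊎_; inj₁; inj₂)
open import Data.Unit using (tt)
open import Function using (_∘_)
open import Relation.Binary.Bundles using (Setoid)
open import Relation.Binary.PropositionalEquality
import Relation.Binary.Reasoning.Setoid as SetoidReasoning
open import Relation.Nullary using (¬_; yes; no; contradiction)

-- Finite sums

∑ : ℕ → (ℕ → ℤ) → ℤ
∑ zero    f = + 0
∑ (suc n) f = f 0 ℤ.+ ∑ n (f ∘ suc)

sumℤ-upTo : ∀ n (f : ℕ → ℤ) → sumℤ (map f (upTo n)) ≡ ∑ n f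
sumℤ-upTo n f = trans (cong sumℤ (map-upTo f n)) (go n f)
  where
  go : ∀ n f → sumℤ (applyUpTo f n) ≡ ∑ n f
  go zero    f = refl
  go (suc n) f = cong (λ z → f 0 ℤ.+ z) (go n (f ∘ suc))

∑-cong< : ∀ n {f g : ℕ → ℤ} → (∀ i → i < n → f i ≡ g i) → ∑ n f ≡ ∑ n g
∑-cong< zero    eq = refl
∑-cong< (suc n) eq = cong₂ ℤ._+_ (eq 0 (s≤s z≤n)) (∑-cong< n (λ i i<n → eq (suc i) (s≤s i<n)))

∑-cong : ∀ n {f g : ℕ → ℤ} → (∀ i → f i ≡ g i) → ∑ n f ≡ ∑ n g
∑-cong n eq = ∑-cong< n (λ i _ → eq i)

∑-zero : ∀ n {f : ℕ → ℤ} → (∀ i → f i ≡ + 0) → ∑ n f ≡ + 0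
∑-zero zero    eq = refl
∑-zero (suc n) eq = cong₂ ℤ._+_ (eq 0) (∑-zero n (eq ∘ suc))

interchange : ∀ a b c d → (a ℤ.+ b) ℤ.+ (c ℤ.+ d) ≡ (a ℤ.+ c) ℤ.+ (b ℤ.+ d)
interchange = ℤ-Solver.solve-∀

∑-+ : ∀ n (f g : ℕ → ℤ) → ∑ n (λ i → f i ℤ.+ g i) ≡ ∑ n f ℤ.+ ∑ n g
∑-+ zero    f g = refl
∑-+ (suc n) f g = trans (cong (λ z → (f 0 ℤ.+ g 0) ℤ.+ z) (∑-+ n (f ∘ suc) (g ∘ suc)))
                        (interchange (f 0) (g 0) (∑ n (f ∘ suc)) (∑ n (g ∘ suc)))

∑-truncate : ∀ {a b} {f : ℕ → ℤ} → a ≤ b → (∀ n → a ≤ n → f n ≡ + 0) → ∑ b f ≡ ∑ a f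
∑-truncate {b = b} z≤n vanish = ∑-zero b (λ n → vanish n z≤n)
∑-truncate {f = f} (s≤s a≤b) vanish =
  cong (λ z → f 0 ℤ.+ z) (∑-truncate a≤b (λ n a≤n → vanish (suc n) (s≤s a≤n)))

-- The substitution a = n + b. It lets the smallest summation variable be chosen before the largest
-- one.
∑-triangle : ∀ N (h : ℕ → ℕ → ℤ) →
  ∑ N (λ a → ∑ (suc a) (h a)) ≡ ∑ N (λ n → ∑ (N ∸ n) (λ b → h (n + b) n))
∑-triangle zero    h = refl
∑-triangle (suc N) h = begin
  ∑ (suc N) (λ a → h a 0 ℤ.+ ∑ a (h a ∘ suc))
    ≡⟨ ∑-+ (suc N) (λ a → h a 0) (λ a → ∑ a (h a ∘ suc)) ⟩
  ∑ (suc N) (λ a → h a 0) ℤ.+ (+ 0 ℤ.+ ∑ N (λ a → ∑ (suc a) (h (suc a) ∘ suc)))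
    ≡⟨ cong (λ z → ∑ (suc N) (λ a → h a 0) ℤ.+ z)
            (trans (ℤₚ.+-identityˡ _) (∑-triangle N (λ a n → h (suc a) (suc n)))) ⟩
  ∑ (suc N) (λ a → h a 0) ℤ.+ ∑ N (λ n → ∑ (N ∸ n) (λ b → h (suc n + b) (suc n))) ∎
  where open ≡-Reasoning

-- Power series

infix 4 _≈_
infixl 6 _⊞_

_≈_ : Series → Series → Set
F ≈ G = ∀ n → F n ≡ G n

≈-refl : ∀ F → F ≈ F
≈-refl F n = refl

≈-sym : ∀ {F G} → F ≈ G → G ≈ F
≈-sym p n = sym (p n)

≈-trans : ∀ {F G H} → F ≈ G → G ≈ H → F ≈ H
≈-trans p q n = trans (p n) (q n)

_⊞_ : Series → Series → Series
(F ⊞ G) n = F n ℤ.+ G n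

⊞-cong : ∀ {F F′ G G′} → F ≈ F′ → G ≈ G′ → F ⊞ G ≈ F′ ⊞ G′
⊞-cong p q n = cong₂ ℤ._+_ (p n) (q n)

⊛-∑ : ∀ F G n → (F ⊛ G) n ≡ ∑ (suc n) (λ i → F i ℤ.* G (n ∸ i))
⊛-∑ F G n = sumℤ-upTo (suc n) (λ i → F i ℤ.* G (n ∸ i))

⊛-zero : ∀ F G → (F ⊛ G) 0 ≡ F 0 ℤ.* G 0
⊛-zero F G = ℤₚ.+-identityʳ _

-- Writing F = F 0 + q (F ∘ suc) gives a recursion on coefficients, so that the ring laws below
-- follow by induction without double sums.
⊛-suc : ∀ F G n → (F ⊛ G) (suc n) ≡ F 0 ℤ.* G (suc n) ℤ.+ ((F ∘ suc) ⊛ G) n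
⊛-suc F G n = trans (⊛-∑ F G (suc n))
  (cong (λ z → F 0 ℤ.* G (suc n) ℤ.+ z) (sym (⊛-∑ (F ∘ suc) G n)))

⊛-cong≤ : ∀ n {F F′ G G′} → (∀ i → i ≤ n → F i ≡ F′ i) → (∀ i → i ≤ n → G i ≡ G′ i) →
  (F ⊛ G) n ≡ (F′ ⊛ G′) n
⊛-cong≤ n {F} {F′} {G} {G′} p q = begin
  (F ⊛ G) n                               ≡⟨ ⊛-∑ F G n ⟩
  ∑ (suc n) (λ i → F i ℤ.* G (n ∸ i))     ≡⟨ ∑-cong< (suc n) (λ { i (s≤s i≤n) →
                                               cong₂ ℤ._*_ (p i i≤n) (q (n ∸ i) (ℕₚ.m∸n≤m n i)) }) ⟩
  ∑ (suc n) (λ i → F′ i ℤ.* G′ (n ∸ i))   ≡⟨ ⊛-∑ F′ G′ n ⟨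
  (F′ ⊛ G′) n                             ∎
  where open ≡-Reasoning

⊛-cong : ∀ {F F′ G G′} → F ≈ F′ → G ≈ G′ → F ⊛ G ≈ F′ ⊛ G′
⊛-cong p q n = ⊛-cong≤ n (λ i _ → p i) (λ i _ → q i)

⊛-congˡ : ∀ F {G G′} → G ≈ G′ → F ⊛ G ≈ F ⊛ G′
⊛-congˡ F = ⊛-cong (≈-refl F)

⊛-congʳ : ∀ G {F F′} → F ≈ F′ → F ⊛ G ≈ F′ ⊛ G
⊛-congʳ G p = ⊛-cong p (≈-refl G)

⊛-distribʳ : ∀ F G H → (F ⊞ G) ⊛ H ≈ (F ⊛ H) ⊞ (G ⊛ H)
⊛-distribʳ F G H zero = begin
  ((F ⊞ G) ⊛ H) 0                         ≡⟨ ⊛-zero (F ⊞ G) H ⟩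
  (F 0 ℤ.+ G 0) ℤ.* H 0                   ≡⟨ ℤₚ.*-distribʳ-+ (H 0) (F 0) (G 0) ⟩
  F 0 ℤ.* H 0 ℤ.+ G 0 ℤ.* H 0             ≡⟨ cong₂ ℤ._+_ (⊛-zero F H) (⊛-zero G H) ⟨
  (F ⊛ H) 0 ℤ.+ (G ⊛ H) 0                 ∎
  where open ≡-Reasoning
⊛-distribʳ F G H (suc n) = begin
  ((F ⊞ G) ⊛ H) (suc n)
    ≡⟨ ⊛-suc (F ⊞ G) H n ⟩
  (F 0 ℤ.+ G 0) ℤ.* H (suc n) ℤ.+ ((F ∘ suc ⊞ G ∘ suc) ⊛ H) n
    ≡⟨ cong₂ ℤ._+_ (ℤₚ.*-distribʳ-+ (H (suc n)) (F 0) (G 0)) (⊛-distribʳ (F ∘ suc) (G ∘ suc) H n) ⟩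
  (F 0 ℤ.* H (suc n) ℤ.+ G 0 ℤ.* H (suc n)) ℤ.+ (((F ∘ suc) ⊛ H) n ℤ.+ ((G ∘ suc) ⊛ H) n)
    ≡⟨ interchange (F 0 ℤ.* H (suc n)) (G 0 ℤ.* H (suc n)) (((F ∘ suc) ⊛ H) n) (((G ∘ suc) ⊛ H) n) ⟩
  (F 0 ℤ.* H (suc n) ℤ.+ ((F ∘ suc) ⊛ H) n) ℤ.+ (G 0 ℤ.* H (suc n) ℤ.+ ((G ∘ suc) ⊛ H) n)
    ≡⟨ cong₂ ℤ._+_ (⊛-suc F H n) (⊛-suc G H n) ⟨
  (F ⊛ H) (suc n) ℤ.+ (G ⊛ H) (suc n) ∎
  where open ≡-Reasoning

⊛-scaleˡ : ∀ c F G n → ((λ i → c ℤ.* F i) ⊛ G) n ≡ c ℤ.* (F ⊛ G) n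
⊛-scaleˡ c F G zero = begin
  ((λ i → c ℤ.* F i) ⊛ G) 0   ≡⟨ ⊛-zero (λ i → c ℤ.* F i) G ⟩
  c ℤ.* F 0 ℤ.* G 0           ≡⟨ ℤₚ.*-assoc c (F 0) (G 0) ⟩
  c ℤ.* (F 0 ℤ.* G 0)         ≡⟨ cong (c ℤ.*_) (⊛-zero F G) ⟨
  c ℤ.* (F ⊛ G) 0             ∎
  where open ≡-Reasoning
⊛-scaleˡ c F G (suc n) = begin
  ((λ i → c ℤ.* F i) ⊛ G) (suc n)
    ≡⟨ ⊛-suc (λ i → c ℤ.* F i) G n ⟩
  c ℤ.* F 0 ℤ.* G (suc n) ℤ.+ ((λ i → c ℤ.* F (suc i)) ⊛ G) n
    ≡⟨ cong₂ ℤ._+_ (ℤₚ.*-assoc c (F 0) (G (suc n))) (⊛-scaleˡ c (F ∘ suc) G n) ⟩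
  c ℤ.* (F 0 ℤ.* G (suc n)) ℤ.+ c ℤ.* ((F ∘ suc) ⊛ G) n
    ≡⟨ ℤₚ.*-distribˡ-+ c (F 0 ℤ.* G (suc n)) (((F ∘ suc) ⊛ G) n) ⟨
  c ℤ.* (F 0 ℤ.* G (suc n) ℤ.+ ((F ∘ suc) ⊛ G) n)
    ≡⟨ cong (c ℤ.*_) (⊛-suc F G n) ⟨
  c ℤ.* (F ⊛ G) (suc n) ∎
  where open ≡-Reasoning

⊛-assoc : ∀ F G H → (F ⊛ G) ⊛ H ≈ F ⊛ (G ⊛ H)
⊛-assoc F G H zero = begin
  ((F ⊛ G) ⊛ H) 0             ≡⟨ ⊛-zero (F ⊛ G) H ⟩
  (F ⊛ G) 0 ℤ.* H 0           ≡⟨ cong (ℤ._* H 0) (⊛-zero F G) ⟩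
  F 0 ℤ.* G 0 ℤ.* H 0         ≡⟨ ℤₚ.*-assoc (F 0) (G 0) (H 0) ⟩
  F 0 ℤ.* (G 0 ℤ.* H 0)       ≡⟨ cong (F 0 ℤ.*_) (⊛-zero G H) ⟨
  F 0 ℤ.* (G ⊛ H) 0           ≡⟨ ⊛-zero F (G ⊛ H) ⟨
  (F ⊛ (G ⊛ H)) 0             ∎
  where open ≡-Reasoning
⊛-assoc F G H (suc n) = begin
  ((F ⊛ G) ⊛ H) (suc n)
    ≡⟨ ⊛-suc (F ⊛ G) H n ⟩
  (F ⊛ G) 0 ℤ.* H (suc n) ℤ.+ (((F ⊛ G) ∘ suc) ⊛ H) n
    ≡⟨ cong₂ (λ a b → a ℤ.* H (suc n) ℤ.+ b) (⊛-zero F G)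
         (trans (⊛-congʳ H (⊛-suc F G) n)
                (trans (⊛-distribʳ (λ i → F 0 ℤ.* G (suc i)) ((F ∘ suc) ⊛ G) H n)
                       (cong₂ ℤ._+_ (⊛-scaleˡ (F 0) (G ∘ suc) H n) (⊛-assoc (F ∘ suc) G H n)))) ⟩
  F 0 ℤ.* G 0 ℤ.* H (suc n) ℤ.+ (F 0 ℤ.* ((G ∘ suc) ⊛ H) n ℤ.+ ((F ∘ suc) ⊛ (G ⊛ H)) n)
    ≡⟨ regroup (F 0) (G 0) (H (suc n)) (((G ∘ suc) ⊛ H) n) (((F ∘ suc) ⊛ (G ⊛ H)) n) ⟩
  F 0 ℤ.* (G 0 ℤ.* H (suc n) ℤ.+ ((G ∘ suc) ⊛ H) n) ℤ.+ ((F ∘ suc) ⊛ (G ⊛ H)) n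
    ≡⟨ cong (λ z → F 0 ℤ.* z ℤ.+ ((F ∘ suc) ⊛ (G ⊛ H)) n) (⊛-suc G H n) ⟨
  F 0 ℤ.* (G ⊛ H) (suc n) ℤ.+ ((F ∘ suc) ⊛ (G ⊛ H)) n
    ≡⟨ ⊛-suc F (G ⊛ H) n ⟨
  (F ⊛ (G ⊛ H)) (suc n) ∎
  where
  open ≡-Reasoning
  regroup : ∀ a b c d e → a ℤ.* b ℤ.* c ℤ.+ (a ℤ.* d ℤ.+ e) ≡ a ℤ.* (b ℤ.* c ℤ.+ d) ℤ.+ e
  regroup = ℤ-Solver.solve-∀

-- The mirror image of `⊛-suc`; comparing the two recursions yields commutativity.
⊛-sucʳ : ∀ F G n → (F ⊛ G) (suc n) ≡ F (suc n) ℤ.* G 0 ℤ.+ (F ⊛ (G ∘ suc)) n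
⊛-sucʳ F G zero = begin
  (F ⊛ G) 1                                    ≡⟨ ⊛-suc F G 0 ⟩
  F 0 ℤ.* G 1 ℤ.+ ((F ∘ suc) ⊛ G) 0            ≡⟨ cong (λ z → F 0 ℤ.* G 1 ℤ.+ z) (⊛-zero (F ∘ suc) G) ⟩
  F 0 ℤ.* G 1 ℤ.+ F 1 ℤ.* G 0                  ≡⟨ ℤₚ.+-comm (F 0 ℤ.* G 1) (F 1 ℤ.* G 0) ⟩
  F 1 ℤ.* G 0 ℤ.+ F 0 ℤ.* G 1                  ≡⟨ cong (λ z → F 1 ℤ.* G 0 ℤ.+ z) (⊛-zero F (G ∘ suc)) ⟨
  F 1 ℤ.* G 0 ℤ.+ (F ⊛ (G ∘ suc)) 0            ∎
  where open ≡-Reasoning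
⊛-sucʳ F G (suc n) = begin
  (F ⊛ G) (suc (suc n))
    ≡⟨ ⊛-suc F G (suc n) ⟩
  F 0 ℤ.* G (suc (suc n)) ℤ.+ ((F ∘ suc) ⊛ G) (suc n)
    ≡⟨ cong (λ z → F 0 ℤ.* G (suc (suc n)) ℤ.+ z) (⊛-sucʳ (F ∘ suc) G n) ⟩
  F 0 ℤ.* G (suc (suc n)) ℤ.+ (F (suc (suc n)) ℤ.* G 0 ℤ.+ ((F ∘ suc) ⊛ (G ∘ suc)) n)
    ≡⟨ swap-heads (F 0 ℤ.* G (suc (suc n))) (F (suc (suc n)) ℤ.* G 0) (((F ∘ suc) ⊛ (G ∘ suc)) n) ⟩
  F (suc (suc n)) ℤ.* G 0 ℤ.+ (F 0 ℤ.* G (suc (suc n)) ℤ.+ ((F ∘ suc) ⊛ (G ∘ suc)) n)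
    ≡⟨ cong (λ z → F (suc (suc n)) ℤ.* G 0 ℤ.+ z) (⊛-suc F (G ∘ suc) n) ⟨
  F (suc (suc n)) ℤ.* G 0 ℤ.+ (F ⊛ (G ∘ suc)) (suc n) ∎
  where
  open ≡-Reasoning
  swap-heads : ∀ a b c → a ℤ.+ (b ℤ.+ c) ≡ b ℤ.+ (a ℤ.+ c)
  swap-heads = ℤ-Solver.solve-∀

⊛-comm : ∀ F G → F ⊛ G ≈ G ⊛ F
⊛-comm F G zero    = trans (⊛-zero F G) (trans (ℤₚ.*-comm (F 0) (G 0)) (sym (⊛-zero G F)))
⊛-comm F G (suc n) = trans (⊛-suc F G n)
  (trans (cong₂ ℤ._+_ (ℤₚ.*-comm (F 0) (G (suc n))) (⊛-comm (F ∘ suc) G n))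
         (sym (⊛-sucʳ G F n)))

⊛-identityˡ : ∀ F → oneS ⊛ F ≈ F
⊛-identityˡ F zero    = trans (⊛-zero oneS F) (ℤₚ.*-identityˡ (F 0))
⊛-identityˡ F (suc n) = begin
  (oneS ⊛ F) (suc n)                               ≡⟨ ⊛-suc oneS F n ⟩
  + 1 ℤ.* F (suc n) ℤ.+ ((λ _ → + 0) ⊛ F) n        ≡⟨ cong₂ ℤ._+_ (ℤₚ.*-identityˡ (F (suc n)))
                                                        (trans (⊛-∑ (λ _ → + 0) F n) (∑-zero (suc n) (λ _ → refl))) ⟩
  F (suc n) ℤ.+ + 0                                ≡⟨ ℤₚ.+-identityʳ (F (suc n)) ⟩
  F (suc n)                                        ∎
  where open ≡-Reasoning

⊛-identityʳ : ∀ F → F ⊛ oneS ≈ F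
⊛-identityʳ F = ≈-trans (⊛-comm F oneS) (⊛-identityˡ F)

⊛-distribˡ : ∀ F G H → F ⊛ (G ⊞ H) ≈ (F ⊛ G) ⊞ (F ⊛ H)
⊛-distribˡ F G H = ≈-trans (⊛-comm F (G ⊞ H))
  (≈-trans (⊛-distribʳ G H F) (⊞-cong (⊛-comm G F) (⊛-comm H F)))

-- Multiplication by powers of q.

shift-suc : ∀ e F n → shift (suc e) F (suc n) ≡ shift e F n
shift-suc zero    F n = refl
shift-suc (suc e) F n = refl

shift-cong≤ : ∀ e n {F G} → (∀ i → i ≤ n → F i ≡ G i) → shift e F n ≡ shift e G n
shift-cong≤ zero    n       eq = eq n ℕₚ.≤-refl
shift-cong≤ (suc e) zero    eq = refl
shift-cong≤ (suc e) (suc n) {F} {G} eq =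
  trans (shift-suc e F n)
        (trans (shift-cong≤ e n (λ i i≤n → eq i (ℕₚ.m≤n⇒m≤1+n i≤n))) (sym (shift-suc e G n)))

shift-cong : ∀ e {F G} → F ≈ G → shift e F ≈ shift e G
shift-cong e eq n = shift-cong≤ e n (λ i _ → eq i)

shift-≡ : ∀ {e e′} F → e ≡ e′ → shift e F ≈ shift e′ F
shift-≡ F refl n = refl

shift-< : ∀ {e n} F → n < e → shift e F n ≡ + 0
shift-< {suc e} {zero}  F _         = refl
shift-< {suc e} {suc n} F (s≤s n<e) = trans (shift-suc e F n) (shift-< F n<e)

shift-⊞ : ∀ e F G → shift e (F ⊞ G) ≈ shift e F ⊞ shift e G
shift-⊞ zero    F G n       = refl
shift-⊞ (suc e) F G zero    = refl
shift-⊞ (suc e) F G (suc n) = trans (shift-suc e (F ⊞ G) n)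
  (trans (shift-⊞ e F G n) (sym (cong₂ ℤ._+_ (shift-suc e F n) (shift-suc e G n))))

shift-shift : ∀ a b F → shift a (shift b F) ≈ shift (a + b) F
shift-shift zero    b F n       = refl
shift-shift (suc a) b F zero    = refl
shift-shift (suc a) b F (suc n) = trans (shift-suc a (shift b F) n)
  (trans (shift-shift a b F n) (sym (shift-suc (a + b) F n)))

shift-⊛ : ∀ e F G → shift e F ⊛ G ≈ shift e (F ⊛ G)
shift-⊛ zero    F G n       = refl
shift-⊛ (suc e) F G zero    = ⊛-zero (shift (suc e) F) G
shift-⊛ (suc e) F G (suc n) = begin
  (shift (suc e) F ⊛ G) (suc n)
    ≡⟨ ⊛-suc (shift (suc e) F) G n ⟩
  + 0 ℤ.+ ((shift (suc e) F ∘ suc) ⊛ G) n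
    ≡⟨ ℤₚ.+-identityˡ _ ⟩
  ((shift (suc e) F ∘ suc) ⊛ G) n
    ≡⟨ ⊛-congʳ G (shift-suc e F) n ⟩
  (shift e F ⊛ G) n
    ≡⟨ shift-⊛ e F G n ⟩
  shift e (F ⊛ G) n
    ≡⟨ shift-suc e (F ⊛ G) n ⟨
  shift (suc e) (F ⊛ G) (suc n) ∎
  where open ≡-Reasoning

⊛-shift : ∀ e F G → F ⊛ shift e G ≈ shift e (F ⊛ G)
⊛-shift e F G = ≈-trans (⊛-comm F (shift e G))
  (≈-trans (shift-⊛ e G F) (shift-cong e (⊛-comm G F)))

-- Reciprocals of the q-Pochhammer symbols.

oneMinusQ^-⊞ : ∀ m → oneMinusQ^ m ⊞ shift m oneS ≈ oneS
oneMinusQ^-⊞ m n = trans (cong (λ z → oneMinusQ^ m n ℤ.+ z) (monomial m n)) (cancel (oneS n) _)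
  where
  monomial : ∀ m n → shift m oneS n ≡ (if m ≡ᵇ n then + 1 else + 0)
  monomial zero    zero    = refl
  monomial zero    (suc n) = refl
  monomial (suc m) zero    = refl
  monomial (suc m) (suc n) = trans (shift-suc m oneS n) (monomial m n)
  cancel : ∀ a b → (a ℤ.- b) ℤ.+ b ≡ a
  cancel = ℤ-Solver.solve-∀

-- `invRev` stores its coefficients in descending order, so zipping with ascending coefficients of G
-- is already a Cauchy product.
invRev-∑ : ∀ F G n → sumℤ (zipWith ℤ._*_ (map G (upTo (suc n))) (invRev F n)) ≡ (G ⊛ recip F) n
invRev-∑ F G n = trans (cong (λ l → sumℤ (zipWith ℤ._*_ l (invRev F n))) (map-upTo G (suc n)))
                       (trans (go G n) (sym (⊛-∑ G (recip F) n)))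
  where
  go : ∀ G n → sumℤ (zipWith ℤ._*_ (applyUpTo G (suc n)) (invRev F n)) ≡
               ∑ (suc n) (λ i → G i ℤ.* recip F (n ∸ i))
  go G zero    = refl
  go G (suc n) = cong (λ z → G 0 ℤ.* recip F (suc n) ℤ.+ z) (go (G ∘ suc) n)

⊛-recip : ∀ F → F 0 ≡ + 1 → F ⊛ recip F ≈ oneS
⊛-recip F F₀ zero    = trans (⊛-zero F (recip F)) (trans (ℤₚ.*-identityʳ (F 0)) F₀)
⊛-recip F F₀ (suc n) = begin
  (F ⊛ recip F) (suc n)
    ≡⟨ ⊛-suc F (recip F) n ⟩
  F 0 ℤ.* recip F (suc n) ℤ.+ ((F ∘ suc) ⊛ recip F) n
    ≡⟨ cong₂ (λ a b → a ℤ.* b ℤ.+ ((F ∘ suc) ⊛ recip F) n) F₀ (cong -_ (invRev-∑ F (F ∘ suc) n)) ⟩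
  + 1 ℤ.* - ((F ∘ suc) ⊛ recip F) n ℤ.+ ((F ∘ suc) ⊛ recip F) n
    ≡⟨ cong (λ z → z ℤ.+ ((F ∘ suc) ⊛ recip F) n) (ℤₚ.*-identityˡ (- ((F ∘ suc) ⊛ recip F) n)) ⟩
  - ((F ∘ suc) ⊛ recip F) n ℤ.+ ((F ∘ suc) ⊛ recip F) n
    ≡⟨ ℤₚ.+-inverseˡ (((F ∘ suc) ⊛ recip F) n) ⟩
  + 0 ∎
  where open ≡-Reasoning

qpoch-head : ∀ n → qpoch n 0 ≡ + 1
qpoch-head zero    = refl
qpoch-head (suc n) = trans (⊛-zero (qpoch n) (oneMinusQ^ (suc n)))
                           (cong (ℤ._* + 1) (qpoch-head n))

recip-unique : ∀ F X → F 0 ≡ + 1 → F ⊛ X ≈ oneS → X ≈ recip F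
recip-unique F X F₀ FX≈1 =
  ≈-trans (≈-sym (⊛-identityˡ X))
  (≈-trans (⊛-congʳ X (≈-sym (≈-trans (⊛-comm (recip F) F) (⊛-recip F F₀))))
  (≈-trans (⊛-assoc (recip F) F X)
  (≈-trans (⊛-congˡ (recip F) FX≈1) (⊛-identityʳ (recip F)))))

invPoch : ℕ → Series
invPoch n = recip (qpoch n)

invPoch-zero : invPoch 0 ≈ oneS
invPoch-zero = ≈-sym (recip-unique oneS oneS refl (⊛-identityˡ oneS))

-- Multiply 1 = (1 - q^(n+1)) + q^(n+1) by 1/(q)_{n+1}. The first product inverts (q)_n, and
-- inverses are unique.
invPoch-suc : ∀ n → invPoch (suc n) ≈ shift (suc n) (invPoch (suc n)) ⊞ invPoch n
invPoch-suc n = ≈-trans (≈-sym (⊛-identityˡ u))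
  (≈-trans (⊛-congʳ u (≈-sym (oneMinusQ^-⊞ (suc n))))
  (≈-trans (⊛-distribʳ o (shift (suc n) oneS) u)
  (λ t → trans (ℤₚ.+-comm ((o ⊛ u) t) _) (cong₂ ℤ._+_ (shifted t) (reduced t)))))
  where
  u o : Series
  u = invPoch (suc n)
  o = oneMinusQ^ (suc n)
  shifted : shift (suc n) oneS ⊛ u ≈ shift (suc n) u
  shifted = ≈-trans (shift-⊛ (suc n) oneS u) (shift-cong (suc n) (⊛-identityˡ u))
  reduced : o ⊛ u ≈ invPoch n
  reduced = recip-unique (qpoch n) (o ⊛ u) (qpoch-head n)
    (≈-trans (≈-sym (⊛-assoc (qpoch n) o u)) (⊛-recip (qpoch (suc n)) (qpoch-head (suc n))))

≈-setoid : Setoid _ _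
≈-setoid = record
  { Carrier       = Series
  ; _≈_           = _≈_
  ; isEquivalence = record { refl = λ {F} → ≈-refl F ; sym = ≈-sym ; trans = ≈-trans }
  }

module ≈-Reasoning = SetoidReasoning ≈-setoid

-- The multisum and its recurrences

-- An infinite sum, cut off separately for each coefficient. The exponents to come are at least n (n
-- - 1) ≥ n - 1, so terms from n = 2 + t on miss q^t; the term n = 1 can have exponent 0, which
-- rules out the cutoff 1 + t.
Σ∞ : (ℕ → Series) → Series
Σ∞ F t = ∑ (2 + t) (λ n → F n t)

Summable : (ℕ → Series) → Set
Summable F = ∀ n t → 2 + t ≤ n → F n t ≡ + 0

Σ∞-cong : ∀ {F G} → (∀ n → F n ≈ G n) → Σ∞ F ≈ Σ∞ G
Σ∞-cong eq t = ∑-cong (2 + t) (λ n → eq n t)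

Σ∞-⊞ : ∀ F G → Σ∞ (λ n → F n ⊞ G n) ≈ Σ∞ F ⊞ Σ∞ G
Σ∞-⊞ F G t = ∑-+ (2 + t) (λ n → F n t) (λ n → G n t)

-- The sum of the tail reaches one index further than that of F; summability kills this extra term.
Σ∞-head : ∀ F → Summable F → Σ∞ F ≈ F 0 ⊞ Σ∞ (F ∘ suc)
Σ∞-head F summable t = cong (λ z → F 0 t ℤ.+ z)
  (sym (∑-truncate (ℕₚ.n≤1+n (1 + t)) (λ n t<n → summable (suc n) t (s≤s t<n))))

shift-zero : ∀ e n {F} → (∀ i → i ≤ n → F i ≡ + 0) → shift e F n ≡ + 0
shift-zero e n {F} eq = trans (shift-cong≤ e n {F} {λ _ → + 0} eq) (go e n)
  where
  go : ∀ e n → shift e (λ _ → + 0) n ≡ + 0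
  go zero    n       = refl
  go (suc e) zero    = refl
  go (suc e) (suc n) = trans (shift-suc e (λ _ → + 0) n) (go e n)

shift-Σ∞ : ∀ e F → Summable F → shift e (Σ∞ F) ≈ Σ∞ (λ n → shift e (F n))
shift-Σ∞ zero    F summable t       = refl
shift-Σ∞ (suc e) F summable zero    = refl
shift-Σ∞ (suc e) F summable (suc t) = begin
  shift (suc e) (Σ∞ F) (suc t)                         ≡⟨ shift-suc e (Σ∞ F) t ⟩
  shift e (Σ∞ F) t                                     ≡⟨ shift-Σ∞ e F summable t ⟩
  ∑ (2 + t) (λ n → shift e (F n) t)                    ≡⟨ ∑-truncate (ℕₚ.n≤1+n (2 + t)) (λ n t<n →
                                                           shift-zero e t (λ i i≤t → summable n i
                                                             (ℕₚ.≤-trans (s≤s (s≤s i≤t)) t<n))) ⟨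
  ∑ (3 + t) (λ n → shift e (F n) t)                    ≡⟨ ∑-cong (3 + t) (λ n → shift-suc e (F n) t) ⟨
  ∑ (3 + t) (λ n → shift (suc e) (F n) (suc t))        ∎
  where open ≡-Reasoning

-- With s² - s as the base of the exponent, the three kinds of variable in the theorem get the
-- natural weights 0, 1 and 2.
pronic : ℕ → ℕ
pronic n = n * (n ∸ 1)

-- Splitting off the smallest summation variable n = s_k: substituting
-- s_i = t_i + n turns s_i² - s_i into t_i² - t_i + 2 n t_i + n (n - 1).
summand : ℕ → ℕ → (ℕ → Series) → ℕ → ℕ → Series
summand k c F e n = shift (k * pronic n + n * (c + k * e)) (invPoch n ⊛ F (e + 2 * n))

-- Here k is the number of variables including the removed one, and c + k e is the total of their
-- weights. The cross terms 2 n t_i raise each remaining weight by 2n, which is why F is taken at e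
-- + 2n.
step : ℕ → ℕ → (ℕ → Series) → ℕ → Series
step k c F e = Σ∞ (summand k c F e)

-- The pronic part of the exponent supplies n and the linear part supplies e. Keeping e in the bound
-- serves large e, where only the term of index 0 survives, and the truncation of the finite sums.
summand-vanish : ∀ k c F e n t → 2 + t ≤ suc n + e → summand (suc k) c F e (suc n) t ≡ + 0
summand-vanish k c F e n t (s≤s t<n+e) = shift-< (invPoch (suc n) ⊛ F (e + 2 * suc n))
  (ℕₚ.≤-trans t<n+e (ℕₚ.+-mono-≤
    (ℕₚ.≤-trans (ℕₚ.m≤n*m n (suc n)) (ℕₚ.m≤n*m (suc n * n) (suc k)))
    (ℕₚ.≤-trans (ℕₚ.m≤n*m e (suc k))
      (ℕₚ.≤-trans (ℕₚ.m≤n+m (suc k * e) c) (ℕₚ.m≤n*m (c + suc k * e) (suc n))))))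

summand-summable : ∀ k c F e → Summable (summand (suc k) c F e)
summand-summable k c F e (suc n) t t<n =
  summand-vanish k c F e n t (ℕₚ.≤-trans t<n (ℕₚ.m≤m+n (suc n) e))

step-cong : ∀ k c {F G} → (∀ y → F y ≈ G y) → ∀ e → step k c F e ≈ step k c G e
step-cong k c F≈G e = Σ∞-cong (λ n →
  shift-cong (k * pronic n + n * (c + k * e)) (⊛-congˡ (invPoch n) (F≈G (e + 2 * n))))

step-reindex : ∀ {k k′ c c′} F e → k ≡ k′ → c ≡ c′ → step k c F e ≈ step k′ c′ F e
step-reindex F e refl refl t = refl

step-⊞ : ∀ k c F G e → step k c (λ y → F y ⊞ G y) e ≈ step k c F e ⊞ step k c G e
step-⊞ k c F G e = ≈-trans (Σ∞-cong split) (Σ∞-⊞ (summand k c F e) (summand k c G e))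
  where
  split : ∀ n → summand k c (λ y → F y ⊞ G y) e n ≈ summand k c F e n ⊞ summand k c G e n
  split n = ≈-trans
    (shift-cong x (⊛-distribˡ (invPoch n) (F (e + 2 * n)) (G (e + 2 * n))))
    (shift-⊞ x (invPoch n ⊛ F (e + 2 * n)) (invPoch n ⊛ G (e + 2 * n)))
    where x = k * pronic n + n * (c + k * e)

shift-⊛-shift : ∀ a b G F → shift a (G ⊛ shift b F) ≈ shift (a + b) (G ⊛ F)
shift-⊛-shift a b G F = ≈-trans (shift-cong a (⊛-shift b G F)) (shift-shift a b (G ⊛ F))

-- At y = e + 2n the factor q^(y a) splits into q^(e a), which leaves the sum, and q^(2 n a), which
-- adds 2a to the total weight.
step-shift : ∀ k c a F e →
  step (suc k) c (λ y → shift (y * a) (F y)) e ≈ shift (e * a) (step (suc k) (c + 2 * a) F e)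
step-shift k c a F e = ≈-trans (Σ∞-cong extract)
  (≈-sym (shift-Σ∞ (e * a) (summand (suc k) (c + 2 * a) F e) (summand-summable k (c + 2 * a) F e)))
  where
  exponents : ∀ k p n c e a →
    k * p + n * (c + k * e) + (e + 2 * n) * a ≡ e * a + (k * p + n * (c + 2 * a + k * e))
  exponents = ℕ-Solver.solve-∀
  extract : ∀ n → summand (suc k) c (λ y → shift (y * a) (F y)) e n ≈
                  shift (e * a) (summand (suc k) (c + 2 * a) F e n)
  extract n = begin
    shift x (invPoch n ⊛ shift ((e + 2 * n) * a) (F (e + 2 * n)))
      ≈⟨ shift-⊛-shift x ((e + 2 * n) * a) (invPoch n) (F (e + 2 * n)) ⟩
    shift (x + (e + 2 * n) * a) P
      ≈⟨ shift-≡ P (exponents (suc k) (pronic n) n c e a) ⟩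
    shift (e * a + x′) P
      ≈⟨ shift-shift (e * a) x′ P ⟨
    shift (e * a) (shift x′ P) ∎
    where
    open ≈-Reasoning
    P = invPoch n ⊛ F (e + 2 * n)
    x = suc k * pronic n + n * (c + suc k * e)
    x′ = suc k * pronic n + n * (c + 2 * a + suc k * e)

-- Carries a whole recurrence from k variables to one more; both recurrences are induced through it.
step-linear : ∀ k c a F G X → (∀ y → F y ≈ G y ⊞ shift (y * a) (X y)) → ∀ e →
  step (suc k) c F e ≈ step (suc k) c G e ⊞ shift (e * a) (step (suc k) (c + 2 * a) X e)
step-linear k c a F G X eq e = begin
  step (suc k) c F e
    ≈⟨ step-cong (suc k) c eq e ⟩
  step (suc k) c (λ y → G y ⊞ shift (y * a) (X y)) e
    ≈⟨ step-⊞ (suc k) c G (λ y → shift (y * a) (X y)) e ⟩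
  step (suc k) c G e ⊞ step (suc k) c (λ y → shift (y * a) (X y)) e
    ≈⟨ ⊞-cong (≈-refl (step (suc k) c G e)) (step-shift k c a X e) ⟩
  step (suc k) c G e ⊞ shift (e * a) (step (suc k) (c + 2 * a) X e) ∎
  where open ≈-Reasoning

-- Replacing x by xq raises each of the k weights by one, hence their total by k.
step-advance : ∀ k c F e → step k (c + k) (F ∘ suc) e ≈ step k c F (suc e)
step-advance k c F e = Σ∞-cong (λ n →
  shift-≡ (invPoch n ⊛ F (suc e + 2 * n)) (exponents k (pronic n) n c e))
  where
  exponents : ∀ k p n c e → k * p + n * (c + k + k * e) ≡ k * p + n * (c + k * suc e)
  exponents = ℕ-Solver.solve-∀

pronic-suc : ∀ n → pronic (suc n) ≡ pronic n + 2 * n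
pronic-suc zero    = refl
pronic-suc (suc n) = go n
  where
  go : ∀ n → (2 + n) * (1 + n) ≡ (1 + n) * n + 2 * (1 + n)
  go = ℕ-Solver.solve-∀

-- 1/(q)_n - q^n/(q)_n = 1/(q)_{n-1}, followed by the index change n ↦ n + 1.
step-telescope : ∀ m j F e →
  step (suc (m + j)) m F e ≈
  step (suc (m + j)) (suc m) F e ⊞
  shift (e * suc j) (step (suc (m + j)) (suc j) (λ y → shift (y * m) (F (suc y))) (suc e))
step-telescope m j F e = begin
  Σ∞ lower
    ≈⟨ Σ∞-head lower (summand-summable (m + j) m F e) ⟩
  upper 0 ⊞ Σ∞ (lower ∘ suc)
    ≈⟨ ⊞-cong (≈-refl (upper 0)) (≈-trans (Σ∞-cong split)
                                          (Σ∞-⊞ (upper ∘ suc) (λ n → shift (e * suc j) (rest n)))) ⟩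
  upper 0 ⊞ (Σ∞ (upper ∘ suc) ⊞ Σ∞ (λ n → shift (e * suc j) (rest n)))
    ≈⟨ (λ t → sym (ℤₚ.+-assoc (upper 0 t) _ _)) ⟩
  (upper 0 ⊞ Σ∞ (upper ∘ suc)) ⊞ Σ∞ (λ n → shift (e * suc j) (rest n))
    ≈⟨ ⊞-cong (Σ∞-head upper (summand-summable (m + j) (suc m) F e))
              (shift-Σ∞ (e * suc j) rest
                (summand-summable (m + j) (suc j) (λ y → shift (y * m) (F (suc y))) (suc e))) ⟨
  Σ∞ upper ⊞ shift (e * suc j) (Σ∞ rest) ∎
  where
  open ≈-Reasoning
  k = suc (m + j)
  lower upper rest : ℕ → Series
  lower = summand k m F e
  upper = summand k (suc m) F e
  rest  = summand k (suc j) (λ y → shift (y * m) (F (suc y))) (suc e)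

  upper-exponent : ∀ k p n m e → k * p + suc n * (m + k * e) + suc n ≡ k * p + suc n * (suc m + k * e)
  upper-exponent = ℕ-Solver.solve-∀

  -- The roles of m and j + 1 are exchanged here. With k = m + (j + 1), the part e k + m free of n
  -- gives e (j + 1) in front and (e + 1) m. The latter joins 2 n m to form the power y m for y = e
  -- + 1 + 2n, and the remaining n (2k + m + k e - 2m) is n (j + 1 + k (e + 1)).
  rest-exponent : ∀ m j e n p →
    suc (m + j) * (p + 2 * n) + suc n * (m + suc (m + j) * e) ≡
    e * suc j + (suc (m + j) * p + n * (suc j + suc (m + j) * suc e) + (suc e + 2 * n) * m)
  rest-exponent = ℕ-Solver.solve-∀

  argument : ∀ e n → e + 2 * suc n ≡ suc (suc e + 2 * n)
  argument = ℕ-Solver.solve-∀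

  split : ∀ n → lower (suc n) ≈ upper (suc n) ⊞ shift (e * suc j) (rest n)
  split n = begin
    shift x (u′ ⊛ Y)
      ≈⟨ shift-cong x (≈-trans (⊛-congʳ Y (invPoch-suc n)) (⊛-distribʳ (shift (suc n) u′) u Y)) ⟩
    shift x ((shift (suc n) u′ ⊛ Y) ⊞ (u ⊛ Y))
      ≈⟨ shift-⊞ x (shift (suc n) u′ ⊛ Y) (u ⊛ Y) ⟩
    shift x (shift (suc n) u′ ⊛ Y) ⊞ shift x (u ⊛ Y)
      ≈⟨ ⊞-cong
           (≈-trans (shift-cong x (shift-⊛ (suc n) u′ Y))
             (≈-trans (shift-shift x (suc n) (u′ ⊛ Y))
                      (shift-≡ (u′ ⊛ Y) (upper-exponent k (pronic (suc n)) n m e))))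
           (≈-trans (shift-≡ (u ⊛ Y)
                       (trans (cong (λ p → k * p + suc n * (m + k * e)) (pronic-suc n))
                              (rest-exponent m j e n (pronic n))))
             (shift-cong (e * suc j + (z + (suc e + 2 * n) * m))
                         (⊛-congˡ u (λ t → cong (λ y → F y t) (argument e n))))) ⟩
    upper (suc n) ⊞ shift (e * suc j + (z + (suc e + 2 * n) * m)) (u ⊛ Y′)
      ≈⟨ ⊞-cong (≈-refl (upper (suc n)))
           (≈-trans (shift-cong (e * suc j) (shift-⊛-shift z ((suc e + 2 * n) * m) u Y′))
                    (shift-shift (e * suc j) (z + (suc e + 2 * n) * m) (u ⊛ Y′))) ⟨
    upper (suc n) ⊞ shift (e * suc j) (shift z (u ⊛ shift ((suc e + 2 * n) * m) Y′)) ∎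
    where
    u = invPoch n
    u′ = invPoch (suc n)
    Y = F (e + 2 * suc n)
    Y′ = F (suc (suc e + 2 * n))
    x = k * pronic (suc n) + suc n * (m + k * e)
    z = k * pronic n + n * (suc j + k * suc e)

-- The multisum in q^e, where s_1 ≥ ⋯ ≥ s_{r+m+j} and the exponent is
-- Σ (s_i² - s_i + w_i s_i) with weights w = (e^j, (e+1)^m, (e+2)^r).
multisum : ℕ → ℕ → ℕ → ℕ → Series
multisum zero    zero    zero    e = oneS
multisum zero    zero    (suc j) e = step (suc j) 0 (multisum 0 0 j) e
multisum zero    (suc m) j       e = step (suc (m + j)) (suc m) (multisum 0 m j) e
multisum (suc r) m       j       e = step (suc (r + m + j)) (2 * suc r + m) (multisum r m j) e

-- The weights (e+1)^j, (e+2)^m can be read from base e + 1 or from base e, where the lowest block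
-- is empty.
multisum-advance : ∀ m j e → multisum 0 m j (suc e) ≈ multisum m j 0 e
multisum-advance zero zero e = ≈-refl oneS
multisum-advance zero (suc j) e = begin
  step (suc j) 0 (multisum 0 0 j) (suc e)
    ≈⟨ step-advance (suc j) 0 (multisum 0 0 j) e ⟨
  step (suc j) (suc j) (multisum 0 0 j ∘ suc) e
    ≈⟨ step-cong (suc j) (suc j) (multisum-advance 0 j) e ⟩
  step (suc j) (suc j) (multisum 0 j 0) e
    ≈⟨ step-reindex (multisum 0 j 0) e (cong suc (sym (ℕₚ.+-identityʳ j))) (refl {x = suc j}) ⟩
  step (suc (j + 0)) (suc j) (multisum 0 j 0) e ∎
  where open ≈-Reasoning
multisum-advance (suc m) j e = begin
  step (suc (m + j)) (suc m) (multisum 0 m j) (suc e)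
    ≈⟨ step-advance (suc (m + j)) (suc m) (multisum 0 m j) e ⟨
  step (suc (m + j)) (suc m + suc (m + j)) (multisum 0 m j ∘ suc) e
    ≈⟨ step-cong (suc (m + j)) (suc m + suc (m + j)) (multisum-advance m j) e ⟩
  step (suc (m + j)) (suc m + suc (m + j)) (multisum m j 0) e
    ≈⟨ step-reindex (multisum m j 0) e (cong suc (sym (ℕₚ.+-identityʳ (m + j)))) (weight m j) ⟩
  step (suc (m + j + 0)) (2 * suc m + j) (multisum m j 0) e ∎
  where
  open ≈-Reasoning
  weight : ∀ m j → suc m + suc (m + j) ≡ 2 * suc m + j
  weight = ℕ-Solver.solve-∀

-- Induction on κ = m + j rather than on m: the step from (m, j) to (m + 1, j) uses the recurrence
-- for (m, j) and also for the mirrored pair (j, m).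
multisum-recurrence₀ : ∀ m j e →
  multisum 0 m (suc j) e ≈ multisum 0 (suc m) j e ⊞ shift (e * suc j) (multisum 0 (suc j) m (suc e))
multisum-recurrence₀ m j = go (m + j) m j refl
  where
  open ≈-Reasoning
  go : ∀ κ m j → m + j ≡ κ → ∀ e →
    multisum 0 m (suc j) e ≈ multisum 0 (suc m) j e ⊞ shift (e * suc j) (multisum 0 (suc j) m (suc e))
  go κ zero j _ e = ≈-trans (step-telescope 0 j (multisum 0 0 j) e)
    (⊞-cong (≈-refl (multisum 0 1 j e))
      (shift-cong (e * suc j)
        (≈-trans
          (step-cong (suc j) (suc j)
            (λ y → ≈-trans (shift-≡ (multisum 0 0 j (suc y)) (ℕₚ.*-zeroʳ y)) (multisum-advance 0 j y))
            (suc e))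
          (step-reindex (multisum 0 j 0) (suc e) (cong suc (sym (ℕₚ.+-identityʳ j))) (refl {x = suc j})))))
  go (suc κ) (suc m) j m+j≡κ e = begin
    step (suc (m + suc j)) (suc m) (multisum 0 m (suc j)) e
      ≈⟨ step-reindex (multisum 0 m (suc j)) e (cong suc (ℕₚ.+-suc m j)) (refl {x = suc m}) ⟩
    step k (suc m) (multisum 0 m (suc j)) e
      ≈⟨ step-linear (suc m + j) (suc m) (suc j) (multisum 0 m (suc j)) (multisum 0 (suc m) j) (L ∘ suc)
           (go κ m j (ℕₚ.suc-injective m+j≡κ)) e ⟩
    A ⊞ shift (e * suc j) (step k (suc m + 2 * suc j) (L ∘ suc) e)
      -- A has total offset m + 1, whereas K(m + 2, j) requires m + 2. Telescoping corrects the
      -- offset at the price of the remainder B.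
      ≈⟨ ⊞-cong (step-telescope (suc m) j (multisum 0 (suc m) j) e)
           (shift-cong (e * suc j) (≈-trans
             (step-reindex (L ∘ suc) e (refl {x = k}) (weight m j))
             (step-advance k (suc j) L e))) ⟩
    (multisum 0 (2 + m) j e ⊞ shift (e * suc j) (B (suc e))) ⊞
    shift (e * suc j) (step k (suc j) L (suc e))
      ≈⟨ (λ t → regroup (multisum 0 (2 + m) j e t) _ _) ⟩
    multisum 0 (2 + m) j e ⊞
    (shift (e * suc j) (step k (suc j) L (suc e)) ⊞ shift (e * suc j) (B (suc e)))
      ≈⟨ ⊞-cong (≈-refl (multisum 0 (2 + m) j e)) (≈-trans
           (shift-cong (e * suc j) reflected)
           (shift-⊞ (e * suc j) (step k (suc j) L (suc e)) (B (suc e)))) ⟨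
    multisum 0 (2 + m) j e ⊞ shift (e * suc j) (multisum 0 (suc j) (suc m) (suc e)) ∎
    where
    k = suc (suc m + j)
    L : ℕ → Series
    L = multisum 0 (suc j) m
    A = step k (suc m) (multisum 0 (suc m) j) e
    B : ℕ → Series
    B = step k (suc j) (λ y → shift (y * suc m) (multisum 0 (suc m) j (suc y)))

    regroup : ∀ a b c → a ℤ.+ b ℤ.+ c ≡ a ℤ.+ (c ℤ.+ b)
    regroup = ℤ-Solver.solve-∀

    weight : ∀ m j → suc m + 2 * suc j ≡ suc j + suc (suc m + j)
    weight = ℕ-Solver.solve-∀

    -- The recurrence for (j, m) shows that the two remainders are the two halves of K(j + 1, m + 1;
    -- e + 1).
    reflected : multisum 0 (suc j) (suc m) (suc e) ≈ step k (suc j) L (suc e) ⊞ B (suc e)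
    reflected = begin
      step (suc (j + suc m)) (suc j) (multisum 0 j (suc m)) (suc e)
        ≈⟨ step-reindex (multisum 0 j (suc m)) (suc e) (cong suc (ℕₚ.+-comm j (suc m))) (refl {x = suc j}) ⟩
      step k (suc j) (multisum 0 j (suc m)) (suc e)
        ≈⟨ step-cong k (suc j)
             (go κ j m (trans (ℕₚ.+-comm j m) (ℕₚ.suc-injective m+j≡κ))) (suc e) ⟩
      step k (suc j) (λ y → L y ⊞ shift (y * suc m) (multisum 0 (suc m) j (suc y))) (suc e)
        ≈⟨ step-⊞ k (suc j) L (λ y → shift (y * suc m) (multisum 0 (suc m) j (suc y))) (suc e) ⟩
      step k (suc j) L (suc e) ⊞ B (suc e) ∎

multisum-recurrence : ∀ r m j e →
  multisum (suc r) m (suc j) e ≈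
  multisum r (2 + m) j e ⊞ shift (e * suc j) (multisum (suc r + suc j) m 0 e)
multisum-recurrence r m j e = begin
  step (suc (r + m + suc j)) (2 * suc r + m) (multisum r m (suc j)) e
    ≈⟨ step-reindex (multisum r m (suc j)) e (cong suc (ℕₚ.+-suc (r + m) j)) (refl {x = 2 * suc r + m}) ⟩
  step k (2 * suc r + m) (multisum r m (suc j)) e
    ≈⟨ step-linear (suc (r + m + j)) (2 * suc r + m) (suc j) (multisum r m (suc j)) (G r)
         (multisum (r + suc j) m 0) (inner r) e ⟩
  step k (2 * suc r + m) (G r) e ⊞
  shift (e * suc j) (step k (2 * suc r + m + 2 * suc j) (multisum (r + suc j) m 0) e)
    ≈⟨ ⊞-cong (outer r)
         (shift-cong (e * suc j)
           (step-reindex (multisum (r + suc j) m 0) e (total r m j) (weight r m j))) ⟩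
  multisum r (2 + m) j e ⊞ shift (e * suc j) (multisum (suc r + suc j) m 0 e) ∎
  where
  open ≈-Reasoning
  k = suc (suc (r + m + j))

  -- The first term of the recurrence one variable below. At r = 0 it is K(m + 1, j), and adding a
  -- variable of total offset m + 2 to it gives K(m + 2, j).
  G : ℕ → ℕ → Series
  G zero    = multisum 0 (suc m) j
  G (suc r) = multisum r (2 + m) j

  inner : ∀ r y → multisum r m (suc j) y ≈ G r y ⊞ shift (y * suc j) (multisum (r + suc j) m 0 y)
  inner zero    y = ≈-trans (multisum-recurrence₀ m j y)
    (⊞-cong (≈-refl (multisum 0 (suc m) j y)) (shift-cong (y * suc j) (multisum-advance (suc j) m y)))
  inner (suc r) y = multisum-recurrence r m j y

  outer : ∀ r → step (suc (suc (r + m + j))) (2 * suc r + m) (G r) e ≈ multisum r (2 + m) j e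
  outer zero    = ≈-refl (multisum 0 (2 + m) j e)
  outer (suc r) = step-reindex (G (suc r)) e (len r m j) (weight′ r m)
    where
    len : ∀ r m j → suc (suc (suc (r + m + j))) ≡ suc (r + suc (suc m) + j)
    len = ℕ-Solver.solve-∀
    weight′ : ∀ r m → 2 * suc (suc r) + m ≡ 2 * suc r + suc (suc m)
    weight′ = ℕ-Solver.solve-∀

  total : ∀ r m j → suc (suc (r + m + j)) ≡ suc (r + suc j + m + 0)
  total = ℕ-Solver.solve-∀
  weight : ∀ r m j → 2 * suc r + m + 2 * suc j ≡ 2 * suc (r + suc j) + m
  weight = ℕ-Solver.solve-∀

summand-zero : ∀ k c F e → summand k c F e 0 ≈ F (e + 0)
summand-zero k c F e = begin
  shift (k * 0 + 0) (invPoch 0 ⊛ F (e + 0))  ≈⟨ shift-≡ (invPoch 0 ⊛ F (e + 0)) (trans (ℕₚ.+-identityʳ (k * 0)) (ℕₚ.*-zeroʳ k)) ⟩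
  invPoch 0 ⊛ F (e + 0)                      ≈⟨ ⊛-congʳ (F (e + 0)) invPoch-zero ⟩
  oneS ⊛ F (e + 0)                           ≈⟨ ⊛-identityˡ (F (e + 0)) ⟩
  F (e + 0)                                  ∎
  where open ≈-Reasoning

step-< : ∀ k c F → (∀ e t → t < e → F e t ≡ oneS t) → ∀ e t → t < e → step (suc k) c F e t ≡ oneS t
step-< k c F F-< e t t<e = begin
  ∑ (2 + t) (λ n → summand (suc k) c F e n t)
    ≡⟨ ∑-truncate {1} {2 + t} {λ n → summand (suc k) c F e n t} (s≤s z≤n)
         (λ { (suc n) _ → summand-vanish k c F e n t (s≤s (ℕₚ.≤-trans t<e (ℕₚ.m≤n+m e n))) }) ⟩
  summand (suc k) c F e 0 t ℤ.+ + 0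
    ≡⟨ ℤₚ.+-identityʳ _ ⟩
  summand (suc k) c F e 0 t
    ≡⟨ summand-zero (suc k) c F e t ⟩
  F (e + 0) t
    ≡⟨ F-< (e + 0) t (ℕₚ.≤-trans t<e (ℕₚ.m≤m+n e 0)) ⟩
  oneS t ∎
  where open ≡-Reasoning

-- All weights are at least e, so any nonzero choice of variables costs at least q^e. These are the
-- initial values of the count.
multisum-< : ∀ r m j e t → t < e → multisum r m j e t ≡ oneS t
multisum-< zero    zero    zero    e t t<e = refl
multisum-< zero    zero    (suc j) = step-< j 0 (multisum 0 0 j) (multisum-< 0 0 j)
multisum-< zero    (suc m) j       = step-< (m + j) (suc m) (multisum 0 m j) (multisum-< 0 m j)
multisum-< (suc r) m       j       = step-< (r + m + j) (2 * suc r + m) (multisum r m j) (multisum-< r m j)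

-- Comparison with lhsPartial

sumℤ-++ : ∀ xs ys → sumℤ (xs ++ ys) ≡ sumℤ xs ℤ.+ sumℤ ys
sumℤ-++ []       ys = sym (ℤₚ.+-identityˡ (sumℤ ys))
sumℤ-++ (x ∷ xs) ys = trans (cong (λ z → x ℤ.+ z) (sumℤ-++ xs ys)) (sym (ℤₚ.+-assoc x (sumℤ xs) (sumℤ ys)))

sumℤ-concatMap : ∀ {A B : Set} (g : B → ℤ) (h : A → List B) xs →
  sumℤ (map g (concatMap h xs)) ≡ sumℤ (map (λ a → sumℤ (map g (h a))) xs)
sumℤ-concatMap g h []       = refl
sumℤ-concatMap g h (x ∷ xs) = begin
  sumℤ (map g (h x ++ concatMap h xs))                        ≡⟨ cong sumℤ (map-++ g (h x) (concatMap h xs)) ⟩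
  sumℤ (map g (h x) ++ map g (concatMap h xs))                ≡⟨ sumℤ-++ (map g (h x)) (map g (concatMap h xs)) ⟩
  sumℤ (map g (h x)) ℤ.+ sumℤ (map g (concatMap h xs))        ≡⟨ cong (λ z → sumℤ (map g (h x)) ℤ.+ z) (sumℤ-concatMap g h xs) ⟩
  sumℤ (map g (h x)) ℤ.+ sumℤ (map (λ a → sumℤ (map g (h a))) xs) ∎
  where open ≡-Reasoning

sumℤ-⊛ : ∀ {A : Set} F (G : A → Series) xs t →
  sumℤ (map (λ s → (F ⊛ G s) t) xs) ≡ (F ⊛ (λ i → sumℤ (map (λ s → G s i) xs))) t
sumℤ-⊛ F G []       t = sym (trans (⊛-∑ F (λ _ → + 0) t) (∑-zero (suc t) (λ i → ℤₚ.*-zeroʳ (F i))))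
sumℤ-⊛ F G (x ∷ xs) t = trans (cong (λ z → (F ⊛ G x) t ℤ.+ z) (sumℤ-⊛ F G xs t))
  (sym (⊛-distribˡ F (G x) (λ i → sumℤ (map (λ s → G s i) xs)) t))

sumℤ-shift : ∀ {A : Set} e (G : A → Series) xs t →
  sumℤ (map (λ s → shift e (G s) t) xs) ≡ shift e (λ i → sumℤ (map (λ s → G s i) xs)) t
sumℤ-shift e G []       t = sym (shift-zero e t (λ _ _ → refl))
sumℤ-shift e G (x ∷ xs) t = trans (cong (λ z → shift e (G x) t ℤ.+ z) (sumℤ-shift e G xs t))
  (sym (shift-⊞ e (G x) (λ i → sumℤ (map (λ s → G s i) xs)) t))

sumOver : ℕ → ℕ → (List ℕ → ℤ) → ℤ
sumOver k N g = sumℤ (map g (decSeqs k N))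

sumOver-suc : ∀ k N g → sumOver (suc k) N g ≡ ∑ (suc N) (λ a → sumOver k a (g ∘ (a ∷_)))
sumOver-suc k N g = begin
  sumOver (suc k) N g
    ≡⟨ sumℤ-concatMap g (λ a → map (a ∷_) (decSeqs k a)) (upTo (suc N)) ⟩
  sumℤ (map (λ a → sumℤ (map g (map (a ∷_) (decSeqs k a)))) (upTo (suc N)))
    ≡⟨ sumℤ-upTo (suc N) (λ a → sumℤ (map g (map (a ∷_) (decSeqs k a)))) ⟩
  ∑ (suc N) (λ a → sumℤ (map g (map (a ∷_) (decSeqs k a))))
    ≡⟨ ∑-cong (suc N) (λ a → cong sumℤ (sym (map-∘ {g = g} {f = a ∷_} (decSeqs k a)))) ⟩
  ∑ (suc N) (λ a → sumOver k a (g ∘ (a ∷_))) ∎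
  where open ≡-Reasoning

sumOver-cong : ∀ k N {g h} → (∀ s → length s ≡ k → g s ≡ h s) → sumOver k N g ≡ sumOver k N h
sumOver-cong zero    N eq = cong (ℤ._+ + 0) (eq [] refl)
sumOver-cong (suc k) N {g} {h} eq = trans (sumOver-suc k N g)
  (trans (∑-cong (suc N) (λ a → sumOver-cong k a (λ s len → eq (a ∷ s) (cong suc len))))
         (sym (sumOver-suc k N h)))

-- `decSeqs` chooses s_1 first, while `step` removes s_k. Subtracting n = s_k from the other entries
-- leaves a decreasing sequence bounded by N - n.
sumOver-last : ∀ k N g →
  sumOver (suc k) N g ≡ ∑ (suc N) (λ n → sumOver k (N ∸ n) (λ t → g (map (n ℕ.+_) t ∷ʳ n)))
sumOver-last zero    N g = sumOver-suc 0 N g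
sumOver-last (suc k) N g = begin
  sumOver (2 + k) N g
    ≡⟨ sumOver-suc (suc k) N g ⟩
  ∑ (suc N) (λ a → sumOver (suc k) a (g ∘ (a ∷_)))
    ≡⟨ ∑-cong (suc N) (λ a → sumOver-last k a (g ∘ (a ∷_))) ⟩
  ∑ (suc N) (λ a → ∑ (suc a) (λ n → sumOver k (a ∸ n) (λ t → g (a ∷ (map (n ℕ.+_) t ∷ʳ n)))))
    ≡⟨ ∑-triangle (suc N) (λ a n → sumOver k (a ∸ n) (λ t → g (a ∷ (map (n ℕ.+_) t ∷ʳ n)))) ⟩
  ∑ (suc N) (λ n → ∑ (suc N ∸ n) (λ b → sumOver k (n + b ∸ n) (λ t → g (n + b ∷ (map (n ℕ.+_) t ∷ʳ n)))))
    ≡⟨ ∑-cong< (suc N) regroup ⟩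
  ∑ (suc N) (λ n → sumOver (suc k) (N ∸ n) (λ t → g (map (n ℕ.+_) t ∷ʳ n))) ∎
  where
  open ≡-Reasoning
  regroup : ∀ n → n < suc N →
    ∑ (suc N ∸ n) (λ b → sumOver k (n + b ∸ n) (λ t → g (n + b ∷ (map (n ℕ.+_) t ∷ʳ n)))) ≡
    sumOver (suc k) (N ∸ n) (λ t → g (map (n ℕ.+_) t ∷ʳ n))
  regroup n (s≤s n≤N) = begin
    ∑ (suc N ∸ n) (λ b → sumOver k (n + b ∸ n) (λ t → g (n + b ∷ (map (n ℕ.+_) t ∷ʳ n))))
      ≡⟨ ∑-cong (suc N ∸ n) (λ b → cong (λ a → sumOver k a (λ t → g (n + b ∷ (map (n ℕ.+_) t ∷ʳ n))))
                                        (ℕₚ.m+n∸m≡n n b)) ⟩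
    ∑ (suc N ∸ n) (λ b → sumOver k b (λ t → g (n + b ∷ (map (n ℕ.+_) t ∷ʳ n))))
      ≡⟨ cong (λ M → ∑ M (λ b → sumOver k b (λ t → g (n + b ∷ (map (n ℕ.+_) t ∷ʳ n)))))
              (ℕₚ.+-∸-assoc 1 n≤N) ⟩
    ∑ (suc (N ∸ n)) (λ b → sumOver k b (λ t → g (n + b ∷ (map (n ℕ.+_) t ∷ʳ n))))
      ≡⟨ sumOver-suc k (N ∸ n) (λ t → g (map (n ℕ.+_) t ∷ʳ n)) ⟨
    sumOver (suc k) (N ∸ n) (λ t → g (map (n ℕ.+_) t ∷ʳ n)) ∎

invPochs : List ℕ → Series
invPochs = foldr (λ d acc → recip (qpoch d) ⊛ acc) oneS

invPochs-∷ʳ : ∀ ds n → invPochs (ds ∷ʳ n) ≈ invPoch n ⊛ invPochs ds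
invPochs-∷ʳ []       n = ≈-refl (invPoch n ⊛ oneS)
invPochs-∷ʳ (d ∷ ds) n = begin
  invPoch d ⊛ invPochs (ds ∷ʳ n)             ≈⟨ ⊛-congˡ (invPoch d) (invPochs-∷ʳ ds n) ⟩
  invPoch d ⊛ (invPoch n ⊛ invPochs ds)      ≈⟨ ⊛-assoc (invPoch d) (invPoch n) (invPochs ds) ⟨
  (invPoch d ⊛ invPoch n) ⊛ invPochs ds      ≈⟨ ⊛-congʳ (invPochs ds) (⊛-comm (invPoch d) (invPoch n)) ⟩
  (invPoch n ⊛ invPoch d) ⊛ invPochs ds      ≈⟨ ⊛-assoc (invPoch n) (invPoch d) (invPochs ds) ⟩
  invPoch n ⊛ (invPoch d ⊛ invPochs ds)      ∎
  where open ≈-Reasoning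

diffs-∷ʳ : ∀ n t → diffs (map (n ℕ.+_) t ∷ʳ n) ≡ diffs t ∷ʳ n
diffs-∷ʳ n []          = refl
diffs-∷ʳ n (a ∷ [])    = cong (_∷ n ∷ []) (ℕₚ.m+n∸m≡n n a)
diffs-∷ʳ n (a ∷ b ∷ t) = cong₂ _∷_ (ℕₚ.[m+n]∸[m+o]≡n∸o n a b) (diffs-∷ʳ n (b ∷ t))

energy : List ℕ → List ℕ → ℕ
energy w s = sumℕ (zipWith (λ a x → pronic x + a * x) w s)

pronic-+ : ∀ n x → pronic (n + x) ≡ pronic n + pronic x + 2 * n * x
pronic-+ zero    x = sym (ℕₚ.+-identityʳ (pronic x))
pronic-+ (suc n) x = begin
  pronic (suc (n + x))                                     ≡⟨ pronic-suc (n + x) ⟩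
  pronic (n + x) + 2 * (n + x)                             ≡⟨ cong (_+ 2 * (n + x)) (pronic-+ n x) ⟩
  pronic n + pronic x + 2 * n * x + 2 * (n + x)            ≡⟨ regroup (pronic n) (pronic x) n x ⟩
  pronic n + 2 * n + pronic x + 2 * suc n * x              ≡⟨ cong (λ z → z + pronic x + 2 * suc n * x) (pronic-suc n) ⟨
  pronic (suc n) + pronic x + 2 * suc n * x                ∎
  where
  open ≡-Reasoning
  regroup : ∀ p p′ n x → p + p′ + 2 * n * x + 2 * (n + x) ≡ p + 2 * n + p′ + 2 * suc n * x
  regroup = ℕ-Solver.solve-∀

-- The cross terms of `pronic-+` become raised weights. Equal lengths make `zipWith` pair the last
-- weight d with n.
energy-∷ʳ : ∀ n d w t → length t ≡ length w →
  energy (w ∷ʳ d) (map (n ℕ.+_) t ∷ʳ n) ≡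
  suc (length w) * pronic n + n * (sumℕ w + d) + energy (map (2 * n ℕ.+_) w) t
energy-∷ʳ n d []      []      _  = last (pronic n) n d
  where
  last : ∀ p n d → p + d * n + 0 ≡ 1 * p + n * (0 + d) + 0
  last = ℕ-Solver.solve-∀
energy-∷ʳ n d (a ∷ w) (x ∷ t) len = begin
  pronic (n + x) + a * (n + x) + energy (w ∷ʳ d) (map (n ℕ.+_) t ∷ʳ n)
    ≡⟨ cong₂ (λ p E → p + a * (n + x) + E) (pronic-+ n x) (energy-∷ʳ n d w t (ℕₚ.suc-injective len)) ⟩
  pronic n + pronic x + 2 * n * x + a * (n + x) +
  (suc (length w) * pronic n + n * (sumℕ w + d) + energy (map (2 * n ℕ.+_) w) t)
    ≡⟨ regroup (pronic n) (pronic x) n x a (length w) (sumℕ w) d (energy (map (2 * n ℕ.+_) w) t) ⟩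
  suc (suc (length w)) * pronic n + n * (a + sumℕ w + d) +
  (pronic x + (2 * n + a) * x + energy (map (2 * n ℕ.+_) w) t) ∎
  where
  open ≡-Reasoning
  regroup : ∀ p p′ n x a l W d E →
    p + p′ + 2 * n * x + a * (n + x) + (suc l * p + n * (W + d) + E) ≡
    suc (suc l) * p + n * (a + W + d) + (p′ + (2 * n + a) * x + E)
  regroup = ℕ-Solver.solve-∀

partialSum : ℕ → List ℕ → ℕ → Series
partialSum k w N t = sumOver k N (λ s → shift (energy w s) (invPochs (diffs s)) t)

-- A sequence with s_1 > N costs at least N + e, so the truncation is invisible for t < N + e. This
-- range is stable: removing n changes N + e to (N - n) + (e + 2n), which is no smaller.
partialSum-∷ʳ : ∀ k w d c e F → length w ≡ k → sumℕ w + d ≡ c + suc k * e →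
  (∀ n N t → t < N + (e + 2 * n) → partialSum k (map (2 * n ℕ.+_) w) N t ≡ F (e + 2 * n) t) →
  ∀ N t → t < N + e → partialSum (suc k) (w ∷ʳ d) N t ≡ step (suc k) c F e t
partialSum-∷ʳ _ w d c e F refl total partialSum≡F N t t<N+e = begin
  partialSum (suc k) (w ∷ʳ d) N t
    ≡⟨ sumOver-last k N (λ s → shift (energy (w ∷ʳ d) s) (invPochs (diffs s)) t) ⟩
  ∑ (suc N) (λ n → sumOver k (N ∸ n) (λ s →
    shift (energy (w ∷ʳ d) (map (n ℕ.+_) s ∷ʳ n)) (invPochs (diffs (map (n ℕ.+_) s ∷ʳ n))) t))
    ≡⟨ ∑-cong< (suc N) inner ⟩
  ∑ (suc N) (λ n → summand (suc k) c F e n t)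
    ≡⟨ truncate (ℕₚ.≤-total (suc N) (2 + t)) ⟩
  ∑ (2 + t) (λ n → summand (suc k) c F e n t) ∎
  where
  open ≡-Reasoning
  k = length w

  -- Either cutoff may be the larger one. The surplus terms vanish in one case by t < N + e, in the
  -- other by summability.
  truncate : suc N ≤ 2 + t ⊎ 2 + t ≤ suc N →
    ∑ (suc N) (λ n → summand (suc k) c F e n t) ≡ ∑ (2 + t) (λ n → summand (suc k) c F e n t)
  truncate (inj₁ N<2+t) = sym (∑-truncate {f = λ n → summand (suc k) c F e n t} N<2+t
    (λ { (suc n) (s≤s N≤n) → summand-vanish k c F e n t
           (s≤s (ℕₚ.≤-trans t<N+e (ℕₚ.+-monoˡ-≤ e N≤n))) }))
  truncate (inj₂ 1+t≤N) = ∑-truncate {f = λ n → summand (suc k) c F e n t} 1+t≤N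
    (λ n → summand-summable k c F e n t)

  inner : ∀ n → n < suc N → sumOver k (N ∸ n) (λ s →
    shift (energy (w ∷ʳ d) (map (n ℕ.+_) s ∷ʳ n)) (invPochs (diffs (map (n ℕ.+_) s ∷ʳ n))) t) ≡
    summand (suc k) c F e n t
  inner n (s≤s n≤N) = begin
    sumOver k (N ∸ n) (λ s →
      shift (energy (w ∷ʳ d) (map (n ℕ.+_) s ∷ʳ n)) (invPochs (diffs (map (n ℕ.+_) s ∷ʳ n))) t)
      ≡⟨ sumOver-cong k (N ∸ n) (λ s len → split s len t) ⟩
    sumOver k (N ∸ n) (λ s → shift x (invPoch n ⊛ P s) t)
      ≡⟨ sumℤ-shift x (λ s → invPoch n ⊛ P s) (decSeqs k (N ∸ n)) t ⟩
    shift x (λ i → sumOver k (N ∸ n) (λ s → (invPoch n ⊛ P s) i)) t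
      ≡⟨ shift-cong x (sumℤ-⊛ (invPoch n) P (decSeqs k (N ∸ n))) t ⟩
    shift x (invPoch n ⊛ partialSum k (map (2 * n ℕ.+_) w) (N ∸ n)) t
      ≡⟨ shift-cong≤ x t (λ i i≤t → ⊛-cong≤ i {invPoch n} (λ _ _ → refl) (λ i′ i′≤i →
           partialSum≡F n (N ∸ n) i′ (bound i′ (ℕₚ.≤-trans i′≤i i≤t)))) ⟩
    shift x (invPoch n ⊛ F (e + 2 * n)) t ∎
    where
    x = suc k * pronic n + n * (c + suc k * e)
    P : List ℕ → Series
    P s = shift (energy (map (2 * n ℕ.+_) w) s) (invPochs (diffs s))

    split : ∀ s → length s ≡ k →
      shift (energy (w ∷ʳ d) (map (n ℕ.+_) s ∷ʳ n)) (invPochs (diffs (map (n ℕ.+_) s ∷ʳ n))) ≈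
      shift x (invPoch n ⊛ P s)
    split s len = ≈-trans
      (shift-cong (energy (w ∷ʳ d) (map (n ℕ.+_) s ∷ʳ n))
        (λ i → trans (cong (λ ds → invPochs ds i) (diffs-∷ʳ n s)) (invPochs-∷ʳ (diffs s) n i)))
      (≈-trans
        (shift-≡ (invPoch n ⊛ invPochs (diffs s))
          (trans (energy-∷ʳ n d w s len)
                 (cong (λ z → suc k * pronic n + n * z + energy (map (2 * n ℕ.+_) w) s) total)))
        (≈-sym (shift-⊛-shift x (energy (map (2 * n ℕ.+_) w) s) (invPoch n) (invPochs (diffs s)))))

    bound : ∀ i → i ≤ t → i < N ∸ n + (e + 2 * n)
    bound i i≤t = ℕₚ.≤-trans (s≤s i≤t) (ℕₚ.≤-trans t<N+e
      (subst (λ M → M + e ≤ N ∸ n + (e + 2 * n)) (ℕₚ.m∸n+n≡m n≤N)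
        (ℕₚ.≤-trans (ℕₚ.m≤m+n (N ∸ n + n + e) n) (ℕₚ.≤-reflexive (regroup (N ∸ n) n e)))))
      where
      regroup : ∀ a n e → a + n + e + n ≡ a + (e + 2 * n)
      regroup = ℕ-Solver.solve-∀

weights : ℕ → ℕ → ℕ → ℕ → List ℕ
weights r m j e = (replicate j e ++ replicate m (1 + e)) ++ replicate r (2 + e)

replicate-∷ʳ : ∀ {A : Set} n (x : A) → replicate (suc n) x ≡ replicate n x ∷ʳ x
replicate-∷ʳ zero    x = refl
replicate-∷ʳ (suc n) x = cong (x ∷_) (replicate-∷ʳ n x)

++-replicate-∷ʳ : ∀ {A : Set} (xs : List A) n x → xs ++ replicate (suc n) x ≡ (xs ++ replicate n x) ∷ʳ x
++-replicate-∷ʳ xs n x = trans (cong (xs ++_) (replicate-∷ʳ n x)) (sym (++-assoc xs (replicate n x) (x ∷ [])))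

weights-m : ∀ m j e → weights 0 (suc m) j e ≡ weights 0 m j e ∷ʳ (1 + e)
weights-m m j e = trans (++-identityʳ _)
  (trans (++-replicate-∷ʳ (replicate j e) m (1 + e)) (cong (_∷ʳ (1 + e)) (sym (++-identityʳ _))))

weights-j : ∀ j e → weights 0 0 (suc j) e ≡ weights 0 0 j e ∷ʳ e
weights-j j e = trans (trans (++-identityʳ _) (++-identityʳ _))
  (trans (replicate-∷ʳ j e) (cong (_∷ʳ e) (sym (trans (++-identityʳ _) (++-identityʳ _)))))

map-weights : ∀ n r m j e → map (2 * n ℕ.+_) (weights r m j e) ≡ weights r m j (e + 2 * n)
map-weights n r m j e = begin
  map f (weights r m j e)
    ≡⟨ map-++ f (replicate j e ++ replicate m (1 + e)) (replicate r (2 + e)) ⟩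
  map f (replicate j e ++ replicate m (1 + e)) ++ map f (replicate r (2 + e))
    ≡⟨ cong (_++ map f (replicate r (2 + e))) (map-++ f (replicate j e) (replicate m (1 + e))) ⟩
  (map f (replicate j e) ++ map f (replicate m (1 + e))) ++ map f (replicate r (2 + e))
    ≡⟨ cong₂ _++_ (cong₂ _++_ (block 0 j) (block 1 m)) (block 2 r) ⟩
  weights r m j (e + 2 * n) ∎
  where
  open ≡-Reasoning
  f : ℕ → ℕ
  f = 2 * n ℕ.+_
  regroup : ∀ n a e → 2 * n + (a + e) ≡ a + (e + 2 * n)
  regroup = ℕ-Solver.solve-∀
  block : ∀ a l → map f (replicate l (a + e)) ≡ replicate l (a + (e + 2 * n))
  block a l = trans (map-replicate f l (a + e)) (cong (replicate l) (regroup n a e))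

length-weights : ∀ r m j e → length (weights r m j e) ≡ r + m + j
length-weights r m j e = begin
  length (weights r m j e)
    ≡⟨ length-++ (replicate j e ++ replicate m (1 + e)) ⟩
  length (replicate j e ++ replicate m (1 + e)) + length (replicate r (2 + e))
    ≡⟨ cong₂ _+_ (trans (length-++ (replicate j e)) (cong₂ _+_ (length-replicate j) (length-replicate m)))
                 (length-replicate r) ⟩
  j + m + r
    ≡⟨ regroup r m j ⟩
  r + m + j ∎
  where
  open ≡-Reasoning
  regroup : ∀ r m j → j + m + r ≡ r + m + j
  regroup = ℕ-Solver.solve-∀

sumℕ-++ : ∀ xs ys → sumℕ (xs ++ ys) ≡ sumℕ xs + sumℕ ys
sumℕ-++ []       ys = refl
sumℕ-++ (x ∷ xs) ys = trans (cong (x ℕ.+_) (sumℕ-++ xs ys)) (sym (ℕₚ.+-assoc x (sumℕ xs) (sumℕ ys)))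

sumℕ-replicate : ∀ n a → sumℕ (replicate n a) ≡ n * a
sumℕ-replicate zero    a = refl
sumℕ-replicate (suc n) a = cong (a ℕ.+_) (sumℕ-replicate n a)

sumℕ-weights : ∀ r m j e → sumℕ (weights r m j e) ≡ 2 * r + m + (r + m + j) * e
sumℕ-weights r m j e = begin
  sumℕ (weights r m j e)
    ≡⟨ sumℕ-++ (replicate j e ++ replicate m (1 + e)) (replicate r (2 + e)) ⟩
  sumℕ (replicate j e ++ replicate m (1 + e)) + sumℕ (replicate r (2 + e))
    ≡⟨ cong₂ _+_ (trans (sumℕ-++ (replicate j e) (replicate m (1 + e)))
                        (cong₂ _+_ (sumℕ-replicate j e) (sumℕ-replicate m (1 + e))))
                 (sumℕ-replicate r (2 + e)) ⟩
  j * e + m * (1 + e) + r * (2 + e)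
    ≡⟨ regroup r m j e ⟩
  2 * r + m + (r + m + j) * e ∎
  where
  open ≡-Reasoning
  regroup : ∀ r m j e → j * e + m * (1 + e) + r * (2 + e) ≡ 2 * r + m + (r + m + j) * e
  regroup = ℕ-Solver.solve-∀

partialSum-multisum : ∀ r m j e N t → t < N + e →
  partialSum (r + m + j) (weights r m j e) N t ≡ multisum r m j e t
partialSum-multisum-shifted : ∀ r m j e n N t → t < N + (e + 2 * n) →
  partialSum (r + m + j) (map (2 * n ℕ.+_) (weights r m j e)) N t ≡ multisum r m j (e + 2 * n) t

partialSum-multisum zero zero zero e N t _ = ℤₚ.+-identityʳ (oneS t)
partialSum-multisum zero zero (suc j) e N t t<N+e =
  trans (cong (λ w → partialSum (suc j) w N t) (weights-j j e))
    (partialSum-∷ʳ j (weights 0 0 j e) e 0 e (multisum 0 0 j) (length-weights 0 0 j e)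
      (trans (cong (_+ e) (sumℕ-weights 0 0 j e)) (ℕₚ.+-comm (j * e) e))
      (partialSum-multisum-shifted 0 0 j e) N t t<N+e)
partialSum-multisum zero (suc m) j e N t t<N+e =
  trans (cong (λ w → partialSum (suc (m + j)) w N t) (weights-m m j e))
    (partialSum-∷ʳ (m + j) (weights 0 m j e) (1 + e) (suc m) e (multisum 0 m j) (length-weights 0 m j e)
      (trans (cong (_+ (1 + e)) (sumℕ-weights 0 m j e)) (total m j e))
      (partialSum-multisum-shifted 0 m j e) N t t<N+e)
  where
  total : ∀ m j e → m + (m + j) * e + (1 + e) ≡ suc m + suc (m + j) * e
  total = ℕ-Solver.solve-∀
partialSum-multisum (suc r) m j e N t t<N+e =
  trans (cong (λ w → partialSum (suc (r + m + j)) w N t)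
              (++-replicate-∷ʳ (replicate j e ++ replicate m (1 + e)) r (2 + e)))
    (partialSum-∷ʳ (r + m + j) (weights r m j e) (2 + e) (2 * suc r + m) e (multisum r m j)
      (length-weights r m j e)
      (trans (cong (_+ (2 + e)) (sumℕ-weights r m j e)) (total r m j e))
      (partialSum-multisum-shifted r m j e) N t t<N+e)
  where
  total : ∀ r m j e → 2 * r + m + (r + m + j) * e + (2 + e) ≡ 2 * suc r + m + suc (r + m + j) * e
  total = ℕ-Solver.solve-∀

partialSum-multisum-shifted r m j e n N t t<N+e =
  trans (cong (λ w → partialSum (r + m + j) w N t) (map-weights n r m j e))
        (partialSum-multisum r m j (e + 2 * n) N t t<N+e)

square-pronic : ∀ x → x * x ≡ pronic x + x
square-pronic zero    = refl
square-pronic (suc x) = go x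
  where
  go : ∀ x → suc x * suc x ≡ suc x * x + suc x
  go = ℕ-Solver.solve-∀

squares : List ℕ → ℕ
squares s = sumℕ (map (λ x → x * x) s)

take≤squares : ∀ j s → sumℕ (take j s) ≤ squares s
take≤squares zero    s       = z≤n
take≤squares (suc j) []      = z≤n
take≤squares (suc j) (x ∷ s) = ℕₚ.+-mono-≤
  (ℕₚ.≤-trans (ℕₚ.m≤n+m x (pronic x)) (ℕₚ.≤-reflexive (sym (square-pronic x)))) (take≤squares j s)

-- The subtracted sum is moved to the other side, which keeps truncated subtraction out of the
-- induction; `take≤squares` later restores it.
squares-energy : ∀ r m j s → length s ≡ j + m + r →
  squares s + sumℕ (drop (j + m) s) ≡ energy (weights r m j 0) s + sumℕ (take j s)
squares-energy zero zero zero [] _ = refl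
squares-energy (suc r) zero zero (x ∷ s) len = begin
  x * x + squares s + (x + sumℕ s)
    ≡⟨ regroup₁ (x * x) x (squares s) (sumℕ s) ⟩
  x * x + x + (squares s + sumℕ s)
    ≡⟨ cong₂ (λ a b → a + x + b) (square-pronic x) (squares-energy r 0 0 s (ℕₚ.suc-injective len)) ⟩
  pronic x + x + x + (energy (weights r 0 0 0) s + 0)
    ≡⟨ regroup₂ (pronic x) x (energy (weights r 0 0 0) s) ⟩
  pronic x + 2 * x + energy (weights r 0 0 0) s + 0 ∎
  where
  open ≡-Reasoning
  regroup₁ : ∀ q x S T → q + S + (x + T) ≡ q + x + (S + T)
  regroup₁ = ℕ-Solver.solve-∀
  regroup₂ : ∀ p x E → p + x + x + (E + 0) ≡ p + 2 * x + E + 0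
  regroup₂ = ℕ-Solver.solve-∀
squares-energy r (suc m) zero (x ∷ s) len = begin
  x * x + squares s + sumℕ (drop m s)
    ≡⟨ ℕₚ.+-assoc (x * x) (squares s) _ ⟩
  x * x + (squares s + sumℕ (drop m s))
    ≡⟨ cong₂ _+_ (square-pronic x) (squares-energy r m 0 s (ℕₚ.suc-injective len)) ⟩
  pronic x + x + (energy (weights r m 0 0) s + 0)
    ≡⟨ regroup (pronic x) x (energy (weights r m 0 0) s) ⟩
  pronic x + 1 * x + energy (weights r m 0 0) s + 0 ∎
  where
  open ≡-Reasoning
  regroup : ∀ p x E → p + x + (E + 0) ≡ p + 1 * x + E + 0
  regroup = ℕ-Solver.solve-∀
squares-energy r m (suc j) (x ∷ s) len = begin
  x * x + squares s + sumℕ (drop (j + m) s)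
    ≡⟨ ℕₚ.+-assoc (x * x) (squares s) _ ⟩
  x * x + (squares s + sumℕ (drop (j + m) s))
    ≡⟨ cong₂ _+_ (square-pronic x) (squares-energy r m j s (ℕₚ.suc-injective len)) ⟩
  pronic x + x + (energy (weights r m j 0) s + sumℕ (take j s))
    ≡⟨ regroup (pronic x) x (energy (weights r m j 0) s) (sumℕ (take j s)) ⟩
  pronic x + 0 + energy (weights r m j 0) s + (x + sumℕ (take j s)) ∎
  where
  open ≡-Reasoning
  regroup : ∀ p x E T → p + x + (E + T) ≡ p + 0 + E + (x + T)
  regroup = ℕ-Solver.solve-∀

expo-energy : ∀ r m j s → length s ≡ r + m + j → expo j r (r + m + j) s ≡ energy (weights r m j 0) s
expo-energy r m j s len = begin
  squares s ∸ sumℕ (take j s) + sumℕ (drop (r + m + j ∸ r) s)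
    ≡⟨ cong (λ d → squares s ∸ sumℕ (take j s) + sumℕ (drop d s)) position ⟩
  squares s ∸ sumℕ (take j s) + sumℕ (drop (j + m) s)
    ≡⟨ ℕₚ.+-∸-comm (sumℕ (drop (j + m) s)) (take≤squares j s) ⟨
  squares s + sumℕ (drop (j + m) s) ∸ sumℕ (take j s)
    ≡⟨ cong (_∸ sumℕ (take j s)) (squares-energy r m j s (trans len (regroup r m j))) ⟩
  energy (weights r m j 0) s + sumℕ (take j s) ∸ sumℕ (take j s)
    ≡⟨ ℕₚ.m+n∸n≡m (energy (weights r m j 0) s) (sumℕ (take j s)) ⟩
  energy (weights r m j 0) s ∎
  where
  open ≡-Reasoning
  regroup : ∀ r m j → r + m + j ≡ j + m + r
  regroup = ℕ-Solver.solve-∀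
  position : r + m + j ∸ r ≡ j + m
  position = trans (cong (_∸ r) (regroup r m j)) (ℕₚ.m+n∸n≡m (j + m) r)

lhsPartial-multisum : ∀ r m j N t → t < N → lhsPartial j r (r + m + j) N t ≡ multisum r m j 0 t
lhsPartial-multisum r m j N t t<N = trans
  (sumOver-cong (r + m + j) N (λ s len → shift-≡ (invPochs (diffs s)) (expo-energy r m j s len) t))
  (partialSum-multisum r m j 0 N t (ℕₚ.≤-trans t<N (ℕₚ.≤-reflexive (sym (ℕₚ.+-identityʳ N)))))

-- Counting frequency sequences

-- A certificate that exactly z lists satisfy P. The number is an integer so that it can be a
-- coefficient of a series.
record Counted (P : List ℕ → Set) (z : ℤ) : Set where
  constructor counted
  field
    list     : List (List ℕ)
    unique   : Unique list
    sound    : ∀ f → f ∈ list → P f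
    complete : ∀ f → P f → f ∈ list
    count    : z ≡ + length list

counted-⇔ : ∀ {P Q y z} → (∀ f → P f → Q f) → (∀ f → Q f → P f) → z ≡ y → Counted P y → Counted Q z
counted-⇔ to from z≡y (counted L u s c n) =
  counted L u (λ f f∈L → to f (s f f∈L)) (λ f q → c f (from f q)) (trans z≡y n)

counted-∅ : ∀ {P} → (∀ f → ¬ P f) → Counted P (+ 0)
counted-∅ none = counted [] [] (λ _ ()) (λ f p → contradiction p (none f)) refl

counted-⊎ : ∀ {P Q y z} → (∀ f → P f → ¬ Q f) → Counted P y → Counted Q z →
  Counted (λ f → P f ⊎ Q f) (y ℤ.+ z)
counted-⊎ {P} {Q} disjoint (counted L u s c n) (counted M u′ s′ c′ n′) = counted (L ++ M)
  (Unique.++⁺ u u′ (λ { {f} (f∈L , f∈M) → disjoint f (s f f∈L) (s′ f f∈M) }))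
  sound
  (λ { f (inj₁ p) → ∈-++⁺ˡ (c f p) ; f (inj₂ q) → ∈-++⁺ʳ L (c′ f q) })
  (trans (cong₂ ℤ._+_ n n′) (cong +_ (sym (length-++ L))))
  where
  sound : ∀ f → f ∈ L ++ M → P f ⊎ Q f
  sound f f∈ with ∈-++⁻ L f∈
  ... | inj₁ f∈L = inj₁ (s f f∈L)
  ... | inj₂ f∈M = inj₂ (s′ f f∈M)

-- Prepending that respects the normal form: a zero in front of the empty sequence leaves it empty.
cons₀ : ℕ → List ℕ → List ℕ
cons₀ zero    []      = []
cons₀ zero    (y ∷ f) = 0 ∷ y ∷ f
cons₀ (suc x) f       = suc x ∷ f

cons₀-injective : ∀ x {f g} → cons₀ x f ≡ cons₀ x g → f ≡ g
cons₀-injective zero    {[]}    {[]}    _    = refl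
cons₀-injective zero    {_ ∷ _} {_ ∷ _} refl = refl
cons₀-injective (suc x)                 refl = refl

at-cons₀-zero : ∀ x f → at (cons₀ x f) 0 ≡ x
at-cons₀-zero zero    []      = refl
at-cons₀-zero zero    (_ ∷ _) = refl
at-cons₀-zero (suc x) f       = refl

at-cons₀-suc : ∀ x f i → at (cons₀ x f) (suc i) ≡ at f i
at-cons₀-suc zero    []      i = refl
at-cons₀-suc zero    (_ ∷ _) i = refl
at-cons₀-suc (suc x) f       i = refl

sizeFrom-cons₀ : ∀ e x f → sizeFrom e (cons₀ x f) ≡ e * x + sizeFrom (suc e) f
sizeFrom-cons₀ e zero    []      = sym (trans (ℕₚ.+-identityʳ (e * 0)) (ℕₚ.*-zeroʳ e))
sizeFrom-cons₀ e zero    (_ ∷ _) = refl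
sizeFrom-cons₀ e (suc x) f       = refl

noTrailingZero-cons₀ : ∀ x f → NoTrailingZero f → NoTrailingZero (cons₀ x f)
noTrailingZero-cons₀ zero    []      _ = tt
noTrailingZero-cons₀ zero    (_ ∷ _) p = p
noTrailingZero-cons₀ (suc x) []      _ = λ ()
noTrailingZero-cons₀ (suc x) (_ ∷ _) p = p

cons₀-view : ∀ f → NoTrailingZero f → ∃ λ g → f ≡ cons₀ (at f 0) g × NoTrailingZero g
cons₀-view []              _ = [] , refl , tt
cons₀-view (zero  ∷ [])    p = contradiction refl p
cons₀-view (suc x ∷ [])    p = [] , refl , tt
cons₀-view (zero  ∷ y ∷ f) p = y ∷ f , refl , p
cons₀-view (suc x ∷ y ∷ f) p = y ∷ f , refl , p

counted-cons₀ : ∀ {P z} x → Counted P z → Counted (λ f → ∃ λ g → f ≡ cons₀ x g × P g) z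
counted-cons₀ {P} x (counted L u s c n) = counted (map (cons₀ x) L)
  (Unique.map⁺ (cons₀-injective x) u)
  sound
  (λ { _ (g , refl , p) → ∈-map⁺ (cons₀ x) (c g p) })
  (trans n (cong +_ (sym (length-map (cons₀ x) L))))
  where
  sound : ∀ f → f ∈ map (cons₀ x) L → ∃ λ g → f ≡ cons₀ x g × P g
  sound f f∈ with ∈-map⁻ (cons₀ x) f∈
  ... | g , g∈L , f≡ = g , f≡ , s g g∈L

-- The entries of f are read as f_e, f_{e+1}, ….
record Gordon (k p e n : ℕ) (f : List ℕ) : Set where
  constructor gordon
  field
    reduced  : NoTrailingZero f
    adjacent : ∀ i → at f i + at f (suc i) ≤ k
    first    : at f 0 ≤ p
    weight   : sizeFrom e f ≡ n

gordon-cons₀ : ∀ {k p e n x g} → x + at g 0 ≤ k → x ≤ p → Gordon k (at g 0) (suc e) n g →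
  Gordon k p e (e * x + n) (cons₀ x g)
gordon-cons₀ {k} {p} {e} {n} {x} {g} x+g≤k x≤p (gordon red adj _ wt) = gordon
  (noTrailingZero-cons₀ x g red)
  adjacent
  (subst (_≤ p) (sym (at-cons₀-zero x g)) x≤p)
  (trans (sizeFrom-cons₀ e x g) (cong (e * x ℕ.+_) wt))
  where
  adjacent : ∀ i → at (cons₀ x g) i + at (cons₀ x g) (suc i) ≤ k
  adjacent zero    = subst (_≤ k) (sym (cong₂ _+_ (at-cons₀-zero x g) (at-cons₀-suc x g 0))) x+g≤k
  adjacent (suc i) = subst (_≤ k) (sym (cong₂ _+_ (at-cons₀-suc x g i) (at-cons₀-suc x g (suc i)))) (adj i)

gordon-uncons₀ : ∀ {k p e n f} → Gordon k p e n f → ∃ λ g → f ≡ cons₀ (at f 0) g × at f 1 ≡ at g 0 ×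
  Gordon k (at g 0) (suc e) (sizeFrom (suc e) g) g × n ≡ e * at f 0 + sizeFrom (suc e) g
gordon-uncons₀ {k} {p} {e} {n} {f} (gordon red adj _ wt) with cons₀-view f red
... | g , f≡ , red′ = g , f≡ , at-suc 0 ,
  gordon red′ (λ i → subst (_≤ k) (cong₂ _+_ (at-suc i) (at-suc (suc i))) (adj (suc i))) ℕₚ.≤-refl refl ,
  trans (sym wt) (trans (cong (sizeFrom e) f≡) (sizeFrom-cons₀ e (at f 0) g))
  where
  at-suc : ∀ i → at f (suc i) ≡ at g i
  at-suc i = trans (cong (λ h → at h (suc i)) f≡) (at-cons₀-suc (at f 0) g i)

gordon-first : ∀ {k p p′ e n f} → at f 0 ≤ p′ → Gordon k p e n f → Gordon k p′ e n f
gordon-first f₀≤p′ (gordon red adj _ wt) = gordon red adj f₀≤p′ wt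

-- Deleting the first entry x is a bijection onto sequences starting at index e + 1. The bound x + p
-- ≤ k makes the adjacency condition at the deleted entry automatic.
counted-head : ∀ {k p e n z} x → Counted (Gordon k p (suc e) n) z → x + p ≤ k →
  Counted (λ f → at f 0 ≡ x × at f 1 ≤ p × Gordon k x e (e * x + n) f) z
counted-head {k} {p} {e} {n} x C x+p≤k = counted-⇔ to from refl (counted-cons₀ x C)
  where
  to : ∀ f → (∃ λ g → f ≡ cons₀ x g × Gordon k p (suc e) n g) →
       at f 0 ≡ x × at f 1 ≤ p × Gordon k x e (e * x + n) f
  to _ (g , refl , G) = at-cons₀-zero x g ,
    subst (_≤ p) (sym (at-cons₀-suc x g 0)) (Gordon.first G) ,
    gordon-cons₀ (ℕₚ.≤-trans (ℕₚ.+-monoʳ-≤ x (Gordon.first G)) x+p≤k) ℕₚ.≤-refl (gordon-first ℕₚ.≤-refl G)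
  from : ∀ f → at f 0 ≡ x × at f 1 ≤ p × Gordon k x e (e * x + n) f →
         ∃ λ g → f ≡ cons₀ x g × Gordon k p (suc e) n g
  from f (refl , f₁≤p , G) with gordon-uncons₀ G
  ... | g , f≡ , f₁≡g₀ , gordon red adj _ _ , n≡ =
    g , f≡ , gordon red adj (subst (_≤ p) f₁≡g₀ f₁≤p) (sym (ℕₚ.+-cancelˡ-≡ (e * at f 0) _ _ n≡))

sizeFrom-≥ : ∀ e x f → NoTrailingZero (x ∷ f) → e ≤ sizeFrom e (x ∷ f)
sizeFrom-≥ e zero    []      p = contradiction refl p
sizeFrom-≥ e (suc x) []      p = ℕₚ.≤-trans (ℕₚ.m≤m*n e (suc x)) (ℕₚ.m≤m+n (e * suc x) 0)
sizeFrom-≥ e x       (y ∷ f) p = ℕₚ.≤-trans (ℕₚ.n≤1+n e)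
  (ℕₚ.≤-trans (sizeFrom-≥ (suc e) y f p) (ℕₚ.m≤n+m (sizeFrom (suc e) (y ∷ f)) (e * x)))

-- A nonempty sequence ends in a nonzero entry of index at least e, so only the empty one has size
-- below e.
counted-small : ∀ k p e n → n < e → Counted (Gordon k p e n) (oneS n)
counted-small k p e zero n<e = counted ([] ∷ []) ([] ∷ [])
  (λ { _ (here refl) → gordon tt (λ _ → z≤n) z≤n refl })
  (λ { []      _                  → here refl
     ; (x ∷ f) (gordon red _ _ wt) →
         contradiction (subst (e ≤_) wt (sizeFrom-≥ e x f red)) (ℕₚ.<⇒≱ n<e) })
  refl
counted-small k p e (suc n) n<e = counted-∅
  (λ { []      (gordon _ _ _ ())
     ; (x ∷ f) (gordon red _ _ wt) →
         contradiction (subst (e ≤_) wt (sizeFrom-≥ e x f red)) (ℕₚ.<⇒≱ n<e) })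

shift-≥ : ∀ e F n → shift e F (e + n) ≡ F n
shift-≥ zero    F n = refl
shift-≥ (suc e) F n = trans (shift-suc e F (e + n)) (shift-≥ e F n)

-- The fuel g bounds how often e can grow before it exceeds n. The recursion either lowers j at
-- fixed e, or raises e and spends one unit of fuel.
counted-gordon : ∀ g m j e n → n < g + e → Counted (Gordon (m + j) j e n) (multisum 0 m j e n)
counted-gordon zero m j e n n<e =
  counted-⇔ (λ _ G → G) (λ _ G → G) (multisum-< 0 m j e n n<e) (counted-small (m + j) j e n n<e)
-- With f_e = 0 the next entry is bounded by k = m alone, which matches K(m, 0; e) = K(0, m; e + 1).
counted-gordon (suc g) m zero e n n<g+e = counted-⇔
  (λ { f (f₀≡0 , _ , G) → subst (λ n′ → Gordon (m + 0) 0 e n′ f) (cong (_+ n) (ℕₚ.*-zeroʳ e)) G })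
  (λ f G → ℕₚ.n≤0⇒n≡0 (Gordon.first G) ,
           ℕₚ.≤-trans (ℕₚ.m≤n+m (at f 1) (at f 0)) (ℕₚ.≤-trans (Gordon.adjacent G 0) (ℕₚ.≤-reflexive (ℕₚ.+-identityʳ m))) ,
           subst (λ n′ → Gordon (m + 0) 0 e n′ f) (sym (cong (_+ n) (ℕₚ.*-zeroʳ e))) G)
  (sym (multisum-advance 0 m e n))
  (counted-head 0
    (subst (λ k → Counted (Gordon k m (suc e) n) (multisum 0 0 m (suc e) n)) (sym (ℕₚ.+-identityʳ m))
      (counted-gordon g 0 m (suc e) n (subst (n <_) (sym (ℕₚ.+-suc g e)) n<g+e)))
    (ℕₚ.≤-reflexive (sym (ℕₚ.+-identityʳ m))))
counted-gordon (suc g) m (suc j) e n n<g+e = counted-⇔ to from (multisum-recurrence₀ m j e n)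
  (counted-⊎ (λ { f G (f₀≡ , _) → contradiction (subst (_≤ j) f₀≡ (Gordon.first G)) (ℕₚ.<⇒≱ (ℕₚ.n<1+n j)) })
    (subst (λ k → Counted (Gordon k j e n) (multisum 0 (suc m) j e n)) (sym (ℕₚ.+-suc m j))
      (counted-gordon (suc g) (suc m) j e n n<g+e))
    heads)
  where
  k = m + suc j
  Heads : List ℕ → Set
  Heads f = at f 0 ≡ suc j × Gordon k (suc j) e n f

  f₁≤ : ∀ f → at f 0 ≡ suc j → at f 0 + at f 1 ≤ k → at f 1 ≤ m
  f₁≤ f f₀≡ adj = ℕₚ.+-cancelˡ-≤ (suc j) (at f 1) m
    (subst₂ _≤_ (cong (_+ at f 1) f₀≡) (ℕₚ.+-comm m (suc j)) adj)

  to : ∀ f → Gordon k j e n f ⊎ Heads f → Gordon k (suc j) e n f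
  to f (inj₁ G)       = gordon-first (ℕₚ.m≤n⇒m≤1+n (Gordon.first G)) G
  to f (inj₂ (_ , G)) = G

  from : ∀ f → Gordon k (suc j) e n f → Gordon k j e n f ⊎ Heads f
  from f G with ℕₚ.m≤n⇒m<n∨m≡n (Gordon.first G)
  ... | inj₁ (s≤s f₀≤j) = inj₁ (gordon-first f₀≤j G)
  ... | inj₂ f₀≡        = inj₂ (f₀≡ , G)

  -- The entry f_e = j + 1 leaves f_{e+1} ≤ m, so K(j + 1, m; e + 1) counts the tails. If e (j + 1)
  -- > n, there are none.
  heads : Counted Heads (shift (e * suc j) (multisum 0 (suc j) m (suc e)) n)
  heads with e * suc j ℕ.≤? n
  ... | yes x≤n = counted-⇔
    (λ { f (f₀≡ , _ , G) → f₀≡ , subst (λ n′ → Gordon k (suc j) e n′ f) (ℕₚ.m+[n∸m]≡n x≤n) G })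
    (λ { f (f₀≡ , G) → f₀≡ , f₁≤ f f₀≡ (Gordon.adjacent G 0) ,
         subst (λ n′ → Gordon k (suc j) e n′ f) (sym (ℕₚ.m+[n∸m]≡n x≤n)) G })
    (trans (cong (shift (e * suc j) (multisum 0 (suc j) m (suc e))) (sym (ℕₚ.m+[n∸m]≡n x≤n)))
           (shift-≥ (e * suc j) (multisum 0 (suc j) m (suc e)) (n ∸ e * suc j)))
    (counted-head (suc j)
      (subst (λ k → Counted (Gordon k m (suc e) (n ∸ e * suc j)) (multisum 0 (suc j) m (suc e) (n ∸ e * suc j)))
             (ℕₚ.+-comm (suc j) m)
             (counted-gordon g (suc j) m (suc e) (n ∸ e * suc j)
               (ℕₚ.≤-trans (s≤s (ℕₚ.m∸n≤m n (e * suc j))) (subst (n <_) (sym (ℕₚ.+-suc g e)) n<g+e))))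
      (ℕₚ.≤-reflexive (ℕₚ.+-comm (suc j) m)))
  ... | no x≰n = subst (Counted Heads) (sym (shift-< (multisum 0 (suc j) m (suc e)) (ℕₚ.≰⇒> x≰n)))
    (counted-∅ (λ { f (f₀≡ , G) → x≰n (overweight f f₀≡ G) }))
    where
    overweight : ∀ f → at f 0 ≡ suc j → Gordon k (suc j) e n f → e * suc j ≤ n
    overweight f f₀≡ G with gordon-uncons₀ G
    ... | g , _ , _ , _ , n≡ = ℕₚ.≤-trans (ℕₚ.m≤m+n (e * suc j) (sizeFrom (suc e) g))
      (ℕₚ.≤-reflexive (trans (cong (λ x → e * x + sizeFrom (suc e) g) (sym f₀≡)) (sym n≡)))

-- The boundary condition with the truncated difference k - r replaced by c.
Boundary : ℕ → ℕ → List ℕ → Set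
Boundary j c f = at f 0 + ((at f 0 + at f 1) ∸ c) ≤ j

-- For r = 0 the threshold is k and the adjacency condition makes the excess vanish. For j = 0 the
-- condition says f_0 = 0 and f_1 ≤ m. Otherwise the recurrence at e = 0 applies, where f_0 has no
-- weight and the shift disappears.
counted-boundary : ∀ r m j n → let k = r + m + j in
  Counted (λ f → Gordon k j 0 n f × Boundary j (m + j) f) (multisum r m j 0 n)
counted-boundary zero m j n = counted-⇔
  (λ f G → G , subst (λ d → at f 0 + d ≤ j) (sym (ℕₚ.m≤n⇒m∸n≡0 (Gordon.adjacent G 0)))
                     (subst (_≤ j) (sym (ℕₚ.+-identityʳ (at f 0))) (Gordon.first G)))
  (λ _ → proj₁)
  refl
  (counted-gordon (suc n) m j 0 n (ℕₚ.m≤m+n (suc n) 0))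
counted-boundary (suc r) m zero n = counted-⇔
  to
  (λ f (G , B) → ℕₚ.n≤0⇒n≡0 (Gordon.first G) , from f G B , G)
  (sym (multisum-advance (suc r) m 0 n))
  (counted-head 0
    (subst (λ k → Counted (Gordon k m 1 n) (multisum 0 (suc r) m 1 n)) (sym (ℕₚ.+-identityʳ (suc r + m)))
      (counted-gordon n (suc r) m 1 n (ℕₚ.≤-reflexive (sym (ℕₚ.+-comm n 1)))))
    (ℕₚ.≤-trans (ℕₚ.m≤n+m m (suc r)) (ℕₚ.m≤m+n (suc r + m) 0)))
  where
  k = suc r + m + 0
  to : ∀ f → at f 0 ≡ 0 × at f 1 ≤ m × Gordon k 0 0 n f → Gordon k 0 0 n f × Boundary 0 (m + 0) f
  to f (f₀≡0 , f₁≤m , G) = G , ℕₚ.≤-reflexive (cong₂ _+_ f₀≡0 (ℕₚ.m≤n⇒m∸n≡0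
    (subst₂ _≤_ (cong (_+ at f 1) (sym f₀≡0)) (sym (ℕₚ.+-identityʳ m)) f₁≤m)))
  from : ∀ f → Gordon k 0 0 n f → Boundary 0 (m + 0) f → at f 1 ≤ m
  from f G B = ℕₚ.≤-trans (ℕₚ.m≤n+m (at f 1) (at f 0)) (ℕₚ.≤-trans
    (ℕₚ.m∸n≡0⇒m≤n (ℕₚ.n≤0⇒n≡0 (ℕₚ.≤-trans (ℕₚ.m≤n+m _ (at f 0)) B)))
    (ℕₚ.≤-reflexive (ℕₚ.+-identityʳ m)))
counted-boundary (suc r) m (suc j) n = counted-⇔ to from
  (trans (multisum-recurrence r m j 0 n)
         (cong (λ z → multisum r (2 + m) j 0 n ℤ.+ z) (sym (multisum-advance (suc r + suc j) m 0 n))))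
  (counted-⊎
    (λ { f (G , _) (f₀≡ , _) → contradiction (subst (_≤ j) f₀≡ (Gordon.first G)) (ℕₚ.<⇒≱ (ℕₚ.n<1+n j)) })
    (subst (λ k → Counted (λ f → Gordon k j 0 n f × Boundary j (2 + m + j) f) (multisum r (2 + m) j 0 n))
           (regroup₁ r m j) (counted-boundary r (2 + m) j n))
    (counted-head (suc j)
      (subst (λ k → Counted (Gordon k m 1 n) (multisum 0 (suc r + suc j) m 1 n)) (regroup₂ r m j)
        (counted-gordon n (suc r + suc j) m 1 n (ℕₚ.≤-reflexive (sym (ℕₚ.+-comm n 1)))))
      (ℕₚ.≤-trans (ℕₚ.m≤n+m (suc j + m) (suc r)) (ℕₚ.≤-reflexive (regroup₃ r m j)))))
  where
  k = suc r + m + suc j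
  regroup₁ : ∀ r m j → r + (2 + m) + j ≡ suc r + m + suc j
  regroup₁ = ℕ-Solver.solve-∀
  regroup₂ : ∀ r m j → suc r + suc j + m ≡ suc r + m + suc j
  regroup₂ = ℕ-Solver.solve-∀
  regroup₃ : ∀ r m j → suc r + (suc j + m) ≡ suc r + m + suc j
  regroup₃ = ℕ-Solver.solve-∀

  ∸-suc-≤ : ∀ x c → x ∸ c ≤ suc (x ∸ suc c)
  ∸-suc-≤ zero    zero    = z≤n
  ∸-suc-≤ zero    (suc c) = z≤n
  ∸-suc-≤ (suc x) zero    = ℕₚ.≤-refl
  ∸-suc-≤ (suc x) (suc c) = ∸-suc-≤ x c

  Low High : List ℕ → Set
  Low f  = Gordon k j 0 n f × Boundary j (2 + m + j) f
  High f = at f 0 ≡ suc j × at f 1 ≤ m × Gordon k (suc j) 0 n f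

  to : ∀ f → Low f ⊎ High f → Gordon k (suc j) 0 n f × Boundary (suc j) (m + suc j) f
  to f (inj₁ (G , B)) = gordon-first (ℕₚ.m≤n⇒m≤1+n (Gordon.first G)) G ,
    (begin
      at f 0 + (at f 0 + at f 1 ∸ (m + suc j))          ≡⟨ cong (λ c → at f 0 + (at f 0 + at f 1 ∸ c)) (ℕₚ.+-suc m j) ⟩
      at f 0 + (at f 0 + at f 1 ∸ suc (m + j))          ≤⟨ ℕₚ.+-monoʳ-≤ (at f 0) (∸-suc-≤ (at f 0 + at f 1) (suc (m + j))) ⟩
      at f 0 + suc (at f 0 + at f 1 ∸ (2 + m + j))      ≡⟨ ℕₚ.+-suc (at f 0) _ ⟩
      suc (at f 0 + (at f 0 + at f 1 ∸ (2 + m + j)))    ≤⟨ s≤s B ⟩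
      suc j                                             ∎)
    where open ℕₚ.≤-Reasoning
  to f (inj₂ (f₀≡ , f₁≤m , G)) = G ,
    ℕₚ.≤-reflexive (trans (cong₂ _+_ f₀≡ (ℕₚ.m≤n⇒m∸n≡0
      (subst₂ _≤_ (cong (_+ at f 1) (sym f₀≡)) (ℕₚ.+-comm (suc j) m) (ℕₚ.+-monoʳ-≤ (suc j) f₁≤m))))
      (ℕₚ.+-identityʳ (suc j)))

  from : ∀ f → Gordon k (suc j) 0 n f × Boundary (suc j) (m + suc j) f → Low f ⊎ High f
  from f (G , B) with ℕₚ.m≤n⇒m<n∨m≡n (Gordon.first G)
  -- Here f_0 = j + 1 exhausts the bound, so the excess over m + j + 1 is zero, that is, f_1 ≤ m.
  ... | inj₂ f₀≡ = inj₂ (f₀≡ ,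
    ℕₚ.+-cancelˡ-≤ (suc j) (at f 1) m (subst₂ _≤_ (cong (_+ at f 1) f₀≡) (ℕₚ.+-comm m (suc j))
      (ℕₚ.m∸n≡0⇒m≤n (ℕₚ.n≤0⇒n≡0 (ℕₚ.+-cancelˡ-≤ (suc j) _ 0
        (ℕₚ.≤-trans (ℕₚ.≤-reflexive (cong (_+ (at f 0 + at f 1 ∸ (m + suc j))) (sym f₀≡)))
          (ℕₚ.≤-trans B (ℕₚ.≤-reflexive (sym (ℕₚ.+-identityʳ (suc j)))))))))) , G)
  ... | inj₁ (s≤s f₀≤j) = inj₁ (gordon-first f₀≤j G , boundary (ℕₚ.≤-total (at f 0 + at f 1) (suc (m + j))))
    where
    -- Up to the old threshold m + j + 1 the new excess is zero and f_0 ≤ j suffices. Above it the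
    -- new excess is exactly one less than the old.
    boundary : at f 0 + at f 1 ≤ suc (m + j) ⊎ suc (m + j) ≤ at f 0 + at f 1 → Boundary j (2 + m + j) f
    boundary (inj₁ small) = subst (λ d → at f 0 + d ≤ j) (sym (ℕₚ.m≤n⇒m∸n≡0 (ℕₚ.m≤n⇒m≤1+n small)))
      (subst (_≤ j) (sym (ℕₚ.+-identityʳ (at f 0))) f₀≤j)
    boundary (inj₂ large) with ℕₚ.m≤n⇒m<n∨m≡n large
    ... | inj₂ equal = boundary (inj₁ (ℕₚ.≤-reflexive (sym equal)))
    ... | inj₁ above = ℕₚ.≤-pred (begin
      suc (at f 0 + (at f 0 + at f 1 ∸ (2 + m + j)))    ≡⟨ ℕₚ.+-suc (at f 0) _ ⟨
      at f 0 + suc (at f 0 + at f 1 ∸ (2 + m + j))      ≡⟨ cong (at f 0 ℕ.+_) (ℕₚ.+-∸-assoc 1 above) ⟨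
      at f 0 + (at f 0 + at f 1 ∸ suc (m + j))          ≡⟨ cong (λ c → at f 0 + (at f 0 + at f 1 ∸ c)) (ℕₚ.+-suc m j) ⟨
      at f 0 + (at f 0 + at f 1 ∸ (m + suc j))          ≤⟨ B ⟩
      suc j                                             ∎)
      where open ℕₚ.≤-Reasoning

theorem1p14 : (j r k : ℕ) → 1 ≤ k → j + r ≤ k → (n : ℕ) →
    Σ (List (List ℕ)) (λ L →
    Unique L ×
    (∀ f → f ∈ L → NoTrailingZero f × Admissible j r k f × size f ≡ n) ×
    (∀ f → NoTrailingZero f → Admissible j r k f → size f ≡ n → f ∈ L) ×
    ∃ (λ N₀ → ∀ N → N₀ ≤ N → lhsPartial j r k N n ≡ + length L))
theorem1p14 j r k _ j+r≤k n =
  list , unique ,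
  (λ f f∈L → to f (sound f f∈L)) ,
  (λ f red adm size≡n → complete f (from f red adm size≡n)) ,
  -- Sequences with s_1 > N have exponent at least N, so the coefficient of q^n is final from N = n
  -- + 1 on.
  suc n , λ N n<N → trans (cong (λ k → lhsPartial j r k N n) (sym k≡))
                          (trans (lhsPartial-multisum r m j N n n<N) count)
  where
  -- The number of variables whose linear term is absent from the exponent.
  m = k ∸ (j + r)

  k≡ : r + m + j ≡ k
  k≡ = trans (regroup r m j) (ℕₚ.m∸n+n≡m j+r≤k)
    where
    regroup : ∀ r m j → r + m + j ≡ m + (j + r)
    regroup = ℕ-Solver.solve-∀

  m+j≡k∸r : m + j ≡ k ∸ r
  m+j≡k∸r = sym (trans (cong (_∸ r) (trans (sym k≡) (ℕₚ.+-assoc r m j))) (ℕₚ.m+n∸m≡n r (m + j)))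

  open Counted (counted-boundary r m j n)

  to : ∀ f → Gordon (r + m + j) j 0 n f × Boundary j (m + j) f →
       NoTrailingZero f × Admissible j r k f × size f ≡ n
  to f (gordon red adj _ size≡n , B) =
    red , ((λ i → subst (at f i + at f (suc i) ≤_) k≡ (adj i)) , subst (λ c → Boundary j c f) m+j≡k∸r B) , size≡n

  from : ∀ f → NoTrailingZero f → Admissible j r k f → size f ≡ n →
         Gordon (r + m + j) j 0 n f × Boundary j (m + j) f
  from f red (adj , B) size≡n =
    gordon red (λ i → subst (at f i + at f (suc i) ≤_) (sym k≡) (adj i))
           (ℕₚ.≤-trans (ℕₚ.m≤m+n (at f 0) _) B) size≡n ,
    subst (λ c → Boundary j c f) (sym m+j≡k∸r) B
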